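{- Let $p$ be a prime and let $L=\{l_1,l_2,\ldots,l_s\}$ and $K=\{k_1,k_2,\ldots,k_r\}$ be two disjoint subsets of $\{0,1,\ldots,p-1\}$ (with $|L|=s$, $|K|=r$). Suppose that $\mathcal{A}=\{A_1,\ldots,A_m\}$ is a family of subsets of $[n]=\{1,2,\ldots,n\}$ such that $|A_i| \pmod{p}\in K$ for all $A_i\in \mathcal{A}$ and $|A_i\cap A_j|\pmod{p}\in L$ for every $i\neq j$. If $n\geq s +\max_{1\leq i\leq r}k_i$, then \[ |\mathcal{A}|\leq {n-1 \choose s}+{n-1 \choose s-1}+\cdots+{n-1 \choose s-2r+1}. \]
   Context: Binomial coefficients ${a\choose b}$ with $b<0$ are interpreted as $0$. -}

module Defs where

open import Data.Nat using (ℕ; zero; suc; _+_; _∸_; _≤_; _⊔_; _≤?_)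
open import Data.Nat.Combinatorics using (_C_)
open import Data.List using (List; foldr)
open import Relation.Nullary using (yes; no)

maxList : List ℕ → ℕ
maxList = foldr _⊔_ 0

-- binomial coefficient (a choose (s - j)) with the convention that it is 0
-- when s - j < 0 (i.e. when j > s)
binomShift : ℕ → ℕ → ℕ → ℕ
binomShift a s j with j ≤? s
... | yes _ = a C (s ∸ j)
... | no  _ = 0

binomSum : ℕ → ℕ → ℕ → ℕ
binomSum a s zero    = 0
binomSum a s (suc t) = binomSum a s t + binomShift a s t

{-# OPTIONS --safe #-}

-- Single out one element of [n] and drop it, so that the members of the family become points of
-- the cube {0,1}^N, N = n − 1.  The polynomials f_i(x) = ∏_{l∈L} (|A_i ∩ x| − l), with the dropped
-- coordinate of x read as 1, have degree ≤ s and are triangular mod p on these points.  All the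
-- points lie on layers |x| at which Q(t) = ∏_{k∈K} (t − k)(t + 1 − k) vanishes mod p, so the f_i
-- stay independent together with the functions Q(|x|) x_I, |I| ≤ s − 2r, provided the latter are
-- independent; the bound is then the difference of two dimensions.
--
-- For that last point, let g have degree ≤ s − 2r and vanish mod p on every layer where Q does
-- not.  Swapping two unequal coordinates gives a difference D g in N − 2 variables, of lower degree
-- and vanishing on the shifted layers, so by induction D g = 0 and g is symmetric.  A symmetric g
-- is a polynomial in |x| of degree < p, and n ≥ s + max K either makes all its layers good or leaves
-- it more good layers, incongruent mod p, than its degree.
module Submission where

open import Defs
open import Data.List using (List)
open import Data.Nat using (ℕ)
open import Data.Nat.Primality using (Prime)

-- Integer functions on the cube: multilinear degree and the monomial basis.

module CubeFunctions where
  open import Data.Bool using (Bool; true; false)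
  open import Data.Fin using (Fin; zero; suc; _↑ˡ_; _↑ʳ_; splitAt)
  open import Data.Fin.Subset using (Subset; ∣_∣; _∩_)
  open import Data.Integer using (ℤ; +_; _+_; _-_; _*_; -_)
  open import Data.Integer.Properties
  open import Data.Integer.Tactic.RingSolver using (solve-∀)
  open import Data.Nat as ℕ using (ℕ; zero; suc)
  open import Data.Product using (Σ; _×_; _,_; proj₁; proj₂)
  open import Data.Sum using (inj₁; inj₂)
  open import Data.Unit using (⊤; tt)
  open import Data.Vec using ([]; _∷_)
  open import Data.Vec.Functional using (_++_)
  open import Data.Vec.Functional.Properties using (lookup-++ˡ; lookup-++ʳ)
  open import Relation.Binary.PropositionalEquality
  open import Algebra.Properties.Semiring.Sum +-*-semiring public

  ⟦_⟧ : Bool → ℕ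
  ⟦ false ⟧ = 0
  ⟦ true  ⟧ = 1

  at : ∀ {N} → Bool → (Subset (suc N) → ℤ) → Subset N → ℤ
  at b F x = F (b ∷ x)

  -- The coefficient of the first variable: on the cube, `F` is `at false F` plus that variable
  -- times `Δ F`.
  Δ : ∀ {N} → (Subset (suc N) → ℤ) → Subset N → ℤ
  Δ F x = F (true ∷ x) - F (false ∷ x)

  -- Deg t F: the multilinear polynomial representing F has degree < t.
  Deg : ∀ {N} → ℕ → (Subset N → ℤ) → Set
  Deg         zero    F = ∀ x → F x ≡ + 0
  Deg {zero}  (suc t) F = ⊤
  Deg {suc N} (suc t) F = Deg (suc t) (at false F) × Deg t (Δ F)

  Deg-cong : ∀ {N} t {F G : Subset N → ℤ} → F ≗ G → Deg t F → Deg t G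
  Deg-cong         zero    F≗G d x = trans (sym (F≗G x)) (d x)
  Deg-cong {zero}  (suc t) F≗G d = tt
  Deg-cong {suc N} (suc t) F≗G (d₀ , d₁) =
    Deg-cong (suc t) (λ x → F≗G _) d₀ ,
    Deg-cong t (λ x → cong₂ _-_ (F≗G _) (F≗G _)) d₁

  Deg-+ : ∀ {N} t {F G : Subset N → ℤ} → Deg t F → Deg t G → Deg t (λ x → F x + G x)
  Deg-+         zero    d e x = cong₂ _+_ (d x) (e x)
  Deg-+ {zero}  (suc t) d e = tt
  Deg-+ {suc N} (suc t) {F} {G} (d₀ , d₁) (e₀ , e₁) =
    Deg-+ (suc t) d₀ e₀ , Deg-cong t (λ x → lemma (F _) (F _) (G _) (G _)) (Deg-+ t d₁ e₁)
    where
    lemma : ∀ a b c d → (a - b) + (c - d) ≡ (a + c) - (b + d)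
    lemma = solve-∀

  Deg-scale : ∀ {N} t c {F : Subset N → ℤ} → Deg t F → Deg t (λ x → c * F x)
  Deg-scale         zero    c d x = trans (cong (c *_) (d x)) (*-zeroʳ c)
  Deg-scale {zero}  (suc t) c d = tt
  Deg-scale {suc N} (suc t) c (d₀ , d₁) =
    Deg-scale (suc t) c d₀ , Deg-cong t (λ x → lemma c _ _) (Deg-scale t c d₁)
    where
    lemma : ∀ c a b → c * (a - b) ≡ c * a - c * b
    lemma = solve-∀

  Deg-sub : ∀ {N} t {F G : Subset N → ℤ} → Deg t F → Deg t G → Deg t (λ x → F x - G x)
  Deg-sub t {F} {G} d e =
    Deg-cong t (λ x → lemma (F x) (G x)) (Deg-+ t d (Deg-scale t (- (+ 1)) e))
    where
    lemma : ∀ a b → a + - (+ 1) * b ≡ a - b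
    lemma = solve-∀

  Deg-zero : ∀ {N} t → Deg {N} t (λ _ → + 0)
  Deg-zero         zero    x = refl
  Deg-zero {zero}  (suc t) = tt
  Deg-zero {suc N} (suc t) = Deg-zero (suc t) , Deg-zero t

  Deg-suc : ∀ {N} t {F : Subset N → ℤ} → Deg t F → Deg (suc t) F
  Deg-suc         zero    d = Deg-cong 1 (λ x → sym (d x)) (Deg-zero 1)
  Deg-suc {zero}  (suc t) d = tt
  Deg-suc {suc N} (suc t) (d₀ , d₁) = Deg-suc (suc t) d₀ , Deg-suc t d₁

  Deg-const : ∀ {N} t c → Deg {N} (suc t) (λ _ → c)
  Deg-const {zero}  t c = tt
  Deg-const {suc N} t c =
    Deg-const t c , Deg-cong t (λ _ → sym (+-inverseʳ c)) (Deg-zero t)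

  -- Discrete product rule. If the first variable occurs in the linear form, the difference of the
  -- product is the form times `Δ F` plus `at true F`, and the latter is `Δ F` plus `at false F`;
  -- each summand stays within the degree bound of `F`.
  Deg-affine : ∀ {N} t (v : Subset N) c {F : Subset N → ℤ} → Deg t F →
               Deg (suc t) (λ x → (+ ∣ v ∩ x ∣ - c) * F x)
  Deg-affine zero v c d =
    Deg-cong 1 (λ x → sym (trans (cong ((+ ∣ v ∩ x ∣ - c) *_) (d x)) (*-zeroʳ (+ ∣ v ∩ x ∣ - c)))) (Deg-zero 1)
  Deg-affine {zero} (suc t) v c d = tt
  Deg-affine {suc N} (suc t) (false ∷ v) c {F} (d₀ , d₁) =
    Deg-affine (suc t) v c d₀ ,
    Deg-cong (suc t) (λ x → lemma (+ ∣ v ∩ x ∣ - c) _ _) (Deg-affine t v c d₁)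
    where
    lemma : ∀ l a b → l * (a - b) ≡ l * a - l * b
    lemma = solve-∀
  Deg-affine {suc N} (suc t) (true ∷ v) c {F} (d₀ , d₁) =
    Deg-affine (suc t) v c d₀ ,
    Deg-cong (suc t) (λ x → lemma (+ ∣ v ∩ x ∣) c _ _)
      (Deg-+ (suc t) (Deg-+ (suc t) (Deg-affine t v c d₁) (Deg-suc t d₁)) d₀)
    where
    lemma : ∀ l c a b → ((l - c) * (a - b) + (a - b)) + b ≡ (+ 1 + l - c) * a - (l - c) * b
    lemma = solve-∀

  sum-++ : ∀ a {b} (f : Fin (a ℕ.+ b) → ℤ) →
           sum f ≡ sum (λ i → f (i ↑ˡ b)) + sum (λ i → f (a ↑ʳ i))
  sum-++ zero    f = sym (+-identityˡ _)
  sum-++ (suc a) f =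
    trans (cong (λ z → f zero + z) (sum-++ a (λ i → f (suc i)))) (sym (+-assoc (f zero) _ _))

  -- The number of multilinear monomials of degree below `t` in `N` variables; the two summands
  -- count those without and with the first variable. `basis` lists their values in this order.
  dim : ℕ → ℕ → ℕ
  dim N       zero    = 0
  dim zero    (suc t) = 1
  dim (suc N) (suc t) = dim N (suc t) ℕ.+ dim N t

  basis : ∀ {N} t → Subset N → Fin (dim N t) → ℤ
  basis {zero}  (suc t) []      j = + 1
  basis {suc N} (suc t) (b ∷ x) = basis (suc t) x ++ (λ j → + ⟦ b ⟧ * basis t x j)

  Deg-basis : ∀ {N} t j → Deg {N} t (λ x → basis t x j)
  Deg-basis {zero}  (suc t) j = tt
  Deg-basis {suc N} (suc t) j with splitAt (dim N (suc t)) j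
  ... | inj₁ i = Deg-basis (suc t) i , Deg-cong t (λ x → sym (+-inverseʳ (basis (suc t) x i))) (Deg-zero t)
  ... | inj₂ i = Deg-zero (suc t) , Deg-cong t (λ x → lemma (basis t x i)) (Deg-basis t i)
    where
    lemma : ∀ a → a ≡ + 1 * a - + 0
    lemma = solve-∀

  spanning : ∀ {N} t (F : Subset N → ℤ) → Deg t F →
             Σ (Fin (dim N t) → ℤ) λ κ → ∀ x → F x ≡ sum (λ j → κ j * basis t x j)
  spanning zero F d = (λ ()) , d
  spanning {zero} (suc t) F d = (λ _ → F []) , λ { [] → lemma (F []) }
    where
    lemma : ∀ a → a ≡ a * + 1 + + 0
    lemma = solve-∀
  spanning {suc N} (suc t) F (d₀ , d₁) = κ₀ ++ κ₁ , λ { (b ∷ x) → expand b x }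
    where
    open ≡-Reasoning
    κ₀ = proj₁ (spanning (suc t) (at false F) d₀)
    κ₁ = proj₁ (spanning t (Δ F) d₁)

    split : ∀ b x → F (b ∷ x) ≡ F (false ∷ x) + + ⟦ b ⟧ * Δ F x
    split false x = sym (+-identityʳ _)
    split true  x = lemma (F (true ∷ x)) (F (false ∷ x))
      where
      lemma : ∀ a b → a ≡ b + + 1 * (a - b)
      lemma = solve-∀

    expand : ∀ b x → F (b ∷ x) ≡ sum (λ j → (κ₀ ++ κ₁) j * basis (suc t) (b ∷ x) j)
    expand b x = begin
      F (b ∷ x)
        ≡⟨ split b x ⟩
      F (false ∷ x) + + ⟦ b ⟧ * Δ F x
        ≡⟨ cong₂ (λ u v → u + + ⟦ b ⟧ * v) (proj₂ (spanning (suc t) (at false F) d₀) x)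
                                           (proj₂ (spanning t (Δ F) d₁) x) ⟩
      sum (λ j → κ₀ j * e₀ j) + + ⟦ b ⟧ * sum (λ j → κ₁ j * basis t x j)
        ≡⟨ cong (λ z → sum (λ j → κ₀ j * e₀ j) + z) (*-distribˡ-sum (+ ⟦ b ⟧) (λ j → κ₁ j * basis t x j)) ⟩
      sum (λ j → κ₀ j * e₀ j) + sum (λ j → + ⟦ b ⟧ * (κ₁ j * basis t x j))
        ≡⟨ cong (λ z → sum (λ j → κ₀ j * e₀ j) + z) (sum-cong-≗ (λ j → lemma (+ ⟦ b ⟧) (κ₁ j) (basis t x j))) ⟩
      sum (λ j → κ₀ j * e₀ j) + sum (λ j → κ₁ j * e₁ j)
        ≡⟨ cong₂ _+_ (sum-cong-≗ (λ j → cong₂ _*_ (lookup-++ˡ κ₀ κ₁ j) (lookup-++ˡ e₀ e₁ j)))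
                     (sum-cong-≗ (λ j → cong₂ _*_ (lookup-++ʳ κ₀ κ₁ j) (lookup-++ʳ e₀ e₁ j))) ⟨
      _ ≡⟨ sum-++ (dim N (suc t)) (λ j → (κ₀ ++ κ₁) j * basis (suc t) (b ∷ x) j) ⟨
      sum (λ j → (κ₀ ++ κ₁) j * basis (suc t) (b ∷ x) j) ∎
      where
      e₀ = basis (suc t) x
      e₁ = λ j → + ⟦ b ⟧ * basis t x j
      lemma : ∀ a b c → a * (b * c) ≡ b * (a * c)
      lemma = solve-∀

-- One-variable integer polynomials and Newton series.

module Polynomials where
  open import Data.Integer using (ℤ; +_; _+_; _-_; _*_)
  open import Data.Integer.Properties
  open import Data.Integer.Tactic.RingSolver using (solve-∀)
  open import Data.List using (List; []; _∷_)
  open import Data.Nat as ℕ using (ℕ; zero; suc; _!)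
  open import Data.Nat.Properties using (≤⇒≤′)
  open import Data.Product using (Σ; _×_; _,_)
  open import Relation.Binary.PropositionalEquality
  open ≡-Reasoning

  -- Poly e f: f is an integer polynomial of degree < e.  Asking for the quotient by t − a
  -- at every point a makes both the ring operations and root counting immediate.
  Poly : ℕ → (ℕ → ℤ) → Set
  Poly zero    f = ∀ t → f t ≡ + 0
  Poly (suc e) f = ∀ a → Σ (ℕ → ℤ) λ g → Poly e g × (∀ t → f t ≡ f a + (+ t - + a) * g t)

  Poly-cong : ∀ e {f g} → f ≗ g → Poly e f → Poly e g
  Poly-cong zero    f≗g h t = trans (sym (f≗g t)) (h t)
  Poly-cong (suc e) {f} {g} f≗g h a with h a
  ... | q , hq , eq = q , hq , λ t →
    trans (sym (f≗g t)) (trans (eq t) (cong (_+ (+ t - + a) * q t) (f≗g a)))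

  Poly-zero : ∀ e → Poly e (λ _ → + 0)
  Poly-zero zero    t = refl
  Poly-zero (suc e) a = (λ _ → + 0) , Poly-zero e ,
    λ t → sym (trans (+-identityˡ _) (*-zeroʳ (+ t - + a)))

  Poly-const : ∀ e c → Poly (suc e) (λ _ → c)
  Poly-const e c a = (λ _ → + 0) , Poly-zero e , λ t → lemma c (+ t - + a)
    where
    lemma : ∀ c u → c ≡ c + u * + 0
    lemma = solve-∀

  Poly-+ : ∀ e {f g} → Poly e f → Poly e g → Poly e (λ t → f t + g t)
  Poly-+ zero    hf hg t = cong₂ _+_ (hf t) (hg t)
  Poly-+ (suc e) {f} {g} hf hg a with hf a | hg a
  ... | q , hq , eq | r , hr , er = (λ t → q t + r t) , Poly-+ e hq hr , λ t →
    trans (cong₂ _+_ (eq t) (er t)) (lemma (f a) (g a) (+ t - + a) (q t) (r t))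
    where
    lemma : ∀ a b u q r → (a + u * q) + (b + u * r) ≡ (a + b) + u * (q + r)
    lemma = solve-∀

  Poly-scale : ∀ e c {f} → Poly e f → Poly e (λ t → c * f t)
  Poly-scale zero    c hf t = trans (cong (c *_) (hf t)) (*-zeroʳ c)
  Poly-scale (suc e) c {f} hf a with hf a
  ... | q , hq , eq = (λ t → c * q t) , Poly-scale e c hq , λ t →
    trans (cong (c *_) (eq t)) (lemma c (f a) (+ t - + a) (q t))
    where
    lemma : ∀ c a u q → c * (a + u * q) ≡ c * a + u * (c * q)
    lemma = solve-∀

  Poly-suc : ∀ e {f} → Poly e f → Poly (suc e) f
  Poly-suc zero    hf = Poly-cong 1 (λ t → sym (hf t)) (Poly-zero 1)
  Poly-suc (suc e) hf a with hf a
  ... | q , hq , eq = q , Poly-suc e hq , eq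

  Poly-mono : ∀ {d e} → d ℕ.≤ e → ∀ {f} → Poly d f → Poly e f
  Poly-mono d≤e = go (≤⇒≤′ d≤e)
    where
    go : ∀ {d e} → d ℕ.≤′ e → ∀ {f} → Poly d f → Poly e f
    go (ℕ.≤′-reflexive refl) h = h
    go (ℕ.≤′-step d≤′e)      h = Poly-suc _ (go d≤′e h)

  Poly-linear* : ∀ e k {f} → Poly e f → Poly (suc e) (λ t → (+ t - + k) * f t)
  Poly-linear* zero    k hf =
    Poly-cong 1 (λ t → sym (trans (cong ((+ t - + k) *_) (hf t)) (*-zeroʳ (+ t - + k)))) (Poly-zero 1)
  Poly-linear* (suc e) k {f} hf a with hf a
  ... | q , hq , eq =
    -- From `t - k = (t - a) + (a - k)`: the quotient of the product at `a` is `f` itself plus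
    -- `a - k` times the quotient of `f`.
    (λ t → f t + (+ a - + k) * q t) ,
    Poly-+ (suc e) hf (Poly-scale (suc e) (+ a - + k) (Poly-suc e hq)) , λ t →
    trans (cong ((+ t - + k) *_) (eq t))
      (trans (lemma (+ t) (+ k) (+ a) (f a) (q t))
             (cong (λ z → (+ a - + k) * f a + (+ t - + a) * (z + (+ a - + k) * q t)) (sym (eq t))))
    where
    lemma : ∀ t k a b q → (t - k) * (b + (t - a) * q) ≡
                          (a - k) * b + (t - a) * ((b + (t - a) * q) + (a - k) * q)
    lemma = solve-∀

  binom : ℕ → ℕ → ℤ
  binom t       zero    = + 1
  binom zero    (suc j) = + 0
  binom (suc t) (suc j) = binom t j + binom t (suc j)

  binom-absorb : ∀ t j → (+ suc j) * binom t (suc j) ≡ (+ t - + j) * binom t j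
  binom-absorb zero    zero    = refl
  binom-absorb zero    (suc j) = trans (*-zeroʳ (+ suc (suc j))) (sym (*-zeroʳ (+ 0 - + suc j)))
  binom-absorb (suc t) zero    = begin
    + 1 * (+ 1 + binom t 1)      ≡⟨ *-distribˡ-+ (+ 1) (+ 1) (binom t 1) ⟩
    + 1 * + 1 + + 1 * binom t 1  ≡⟨ cong (λ z → + 1 + z) (binom-absorb t 0) ⟩
    + 1 + (+ t - + 0) * + 1      ≡⟨ lemma (+ t) ⟩
    (+ 1 + + t - + 0) * + 1      ∎
    where
    lemma : ∀ t → + 1 + (t - + 0) * + 1 ≡ (+ 1 + t - + 0) * + 1
    lemma = solve-∀
  binom-absorb (suc t) (suc j) = begin
    (+ 2 + + j) * (b + c)                          ≡⟨ *-distribˡ-+ (+ 2 + + j) b c ⟩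
    (+ 2 + + j) * b + (+ 2 + + j) * c              ≡⟨ cong (λ z → (+ 2 + + j) * b + z) (binom-absorb t (suc j)) ⟩
    (+ 2 + + j) * b + (+ t - (+ 1 + + j)) * b      ≡⟨ lemma (+ t) (+ j) b ⟩
    (+ t - + j) * b + (+ 1 + + j) * b              ≡⟨ cong (λ z → (+ t - + j) * b + z) (binom-absorb t j) ⟩
    (+ t - + j) * b + (+ t - + j) * a              ≡⟨ lemma₂ (+ t) (+ j) a b ⟩
    (+ 1 + + t - (+ 1 + + j)) * (a + b)            ∎
    where
    a = binom t j
    b = binom t (suc j)
    c = binom t (suc (suc j))
    lemma : ∀ t j b → (+ 2 + j) * b + (t - (+ 1 + j)) * b ≡ (t - j) * b + (+ 1 + j) * b
    lemma = solve-∀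
    lemma₂ : ∀ t j a b → (t - j) * b + (t - j) * a ≡ (+ 1 + t - (+ 1 + j)) * (a + b)
    lemma₂ = solve-∀

  -- The factor `j !` clears denominators: the product is a falling factorial, and `binom-absorb`
  -- supplies one new linear factor per step.
  Poly-binom : ∀ j → Poly (suc j) (λ t → + (j !) * binom t j)
  Poly-binom zero    = Poly-const 0 (+ 1)
  Poly-binom (suc j) = Poly-cong (suc (suc j)) falling (Poly-linear* (suc j) j (Poly-binom j))
    where
    swap : ∀ a b c → a * (b * c) ≡ b * (a * c)
    swap = solve-∀
    falling : ∀ t → (+ t - + j) * (+ (j !) * binom t j) ≡ + (suc j !) * binom t (suc j)
    falling t = begin
      (+ t - + j) * (+ (j !) * binom t j)    ≡⟨ swap (+ t - + j) (+ (j !)) (binom t j) ⟩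
      + (j !) * ((+ t - + j) * binom t j)    ≡⟨ cong (+ (j !) *_) (binom-absorb t j) ⟨
      + (j !) * (+ suc j * binom t (suc j))  ≡⟨ swap (+ (j !)) (+ suc j) (binom t (suc j)) ⟩
      + suc j * (+ (j !) * binom t (suc j))  ≡⟨ *-assoc (+ suc j) (+ (j !)) _ ⟨
      + suc j * + (j !) * binom t (suc j)    ≡⟨ cong (_* binom t (suc j)) (pos-* (suc j) (j !)) ⟨
      + (suc j !) * binom t (suc j)          ∎

  -- Newton's forward series: the list holds the coefficients of `binom t j`, `binom t (suc j)`, and
  -- so on.
  newton : List ℤ → ℕ → ℕ → ℤ
  newton []       j t = + 0
  newton (c ∷ cs) j t = c * binom t j + newton cs (suc j) t

  newton-at-0 : ∀ cs j → newton cs (suc j) 0 ≡ + 0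
  newton-at-0 []       j = refl
  newton-at-0 (c ∷ cs) j = cong₂ _+_ (*-zeroʳ c) (newton-at-0 cs (suc j))

  -- Pascal's rule termwise: the forward difference in `t` lowers every index by one.
  newton-step : ∀ cs j t → newton cs (suc j) (suc t) ≡ newton cs j t + newton cs (suc j) t
  newton-step []       j t = refl
  newton-step (c ∷ cs) j t = trans
    (cong (λ z → c * (binom t j + binom t (suc j)) + z) (newton-step cs (suc j) t))
    (lemma c (binom t j) (binom t (suc j)) (newton cs (suc j) t) (newton cs (suc (suc j)) t))
    where
    lemma : ∀ c a b n m → c * (a + b) + (n + m) ≡ (c * a + n) + (c * b + m)
    lemma = solve-∀

-- Divisibility by a prime and congruences.

module Modular (p : ℕ) (p-prime : Prime p) where
  open CubeFunctions
  open Polynomials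
  open import Data.Bool using (true; false)
  open import Data.Fin using (Fin; zero; suc; _↑ˡ_; _↑ʳ_; splitAt; punchIn; punchOut)
  open import Data.Fin.Properties using (splitAt⁻¹-↑ˡ; splitAt⁻¹-↑ʳ; any?; punchIn-punchOut; _≟_)
  open import Data.Fin.Subset using (Subset; ∣_∣)
  open import Data.Fin.Subset.Properties using (∣p∣≤n)
  open import Data.Integer as ℤ using (ℤ; +_; _+_; _-_; _*_; -_)
  open import Data.Integer.Divisibility.Signed using (_∣_; divides; ∣ᵤ⇒∣; ∣⇒∣ᵤ; _∣?_; ∣m∣n⇒∣m+n; ∣m∣n⇒∣m-n; ∣m⇒∣-m; ∣n⇒∣m*n; ∣m⇒∣m*n; ∣m+n∣m⇒∣n)
  open import Data.Integer.Properties hiding (_≟_)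
  open import Data.Integer.Tactic.RingSolver using (solve-∀)
  open import Data.List using (List; []; _∷_; length)
  open import Data.List.Relation.Unary.All as All using (All; []; _∷_)
  open import Data.List.Relation.Unary.AllPairs using (AllPairs; []; _∷_)
  open import Data.Nat as ℕ using (zero; suc; z≤n; s≤s; _!)
  import Data.Nat.Divisibility as ℕ∣
  import Data.Nat.Properties as ℕₚ
  open import Data.Nat.Primality using (euclidsLemma; prime⇒nonTrivial)
  open import Data.Product using (Σ; ∃; _×_; _,_; proj₁; proj₂)
  open import Data.Sum using (_⊎_; inj₁; inj₂; [_,_]′)
  open import Data.Unit using (⊤; tt)
  open import Data.Vec using ([]; _∷_)
  open import Data.Vec.Functional.Properties using (lookup-++ˡ; lookup-++ʳ)
  open import Function using (_∘_)
  open import Relation.Binary.PropositionalEquality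
  open import Relation.Nullary using (¬_; yes; no; ¬?; contradiction)
  open import Relation.Nullary.Decidable using (decidable-stable)
  open ≡-Reasoning

  infix 4 p∣_ p∤_ _≈_

  p∣_ : ℤ → Set
  p∣ a = + p ∣ a

  p∤_ : ℤ → Set
  p∤ a = ¬ p∣ a

  p∣0 : p∣ + 0
  p∣0 = divides (+ 0) refl

  p∤positive<p : ∀ {a} → 0 ℕ.< a → a ℕ.< p → p∤ + a
  p∤positive<p {suc a} _ a<p p∣a = ℕₚ.<⇒≱ a<p (ℕ∣.∣⇒≤ (∣⇒∣ᵤ p∣a))

  p∤difference : ∀ {a b} → a ℕ.< b → b ℕ.< p → p∤ (+ b - + a)
  p∤difference {a} {b} a<b b<p =
    subst p∤_ (sym (trans (m-n≡m⊖n b a) (⊖-≥ (ℕₚ.<⇒≤ a<b))))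
      (p∤positive<p (ℕₚ.m<n⇒0<n∸m a<b) (ℕₚ.≤-<-trans (ℕₚ.m∸n≤m b a) b<p))

  p∤1 : p∤ + 1
  p∤1 = p∤positive<p (s≤s z≤n) (ℕ.nonTrivial⇒n>1 p ⦃ prime⇒nonTrivial p-prime ⦄)

  p∤-* : ∀ a b → p∤ a → p∤ b → p∤ a * b
  p∤-* a b p∤a p∤b p∣ab =
    [ p∤a ∘ ∣ᵤ⇒∣ , p∤b ∘ ∣ᵤ⇒∣ ]′
      (euclidsLemma ℤ.∣ a ∣ ℤ.∣ b ∣ p-prime (subst (p ℕ∣.∣_) (abs-* a b) (∣⇒∣ᵤ p∣ab)))

  p∣-cancelˡ : ∀ a b → p∤ a → p∣ a * b → p∣ b
  p∣-cancelˡ a b p∤a p∣ab = decidable-stable (+ p ∣? b) (λ p∤b → p∤-* a b p∤a p∤b p∣ab)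

  p∤-! : ∀ j → j ℕ.< p → p∤ + (j !)
  p∤-! zero    _   = p∤1
  p∤-! (suc j) j<p = subst p∤_ (sym (pos-* (suc j) (j !)))
    (p∤-* (+ suc j) (+ (j !)) (p∤positive<p (s≤s z≤n) j<p) (p∤-! j (ℕₚ.<-trans (ℕₚ.n<1+n j) j<p)))

  p∣-sum : ∀ {n} (f : Fin n → ℤ) → (∀ i → p∣ f i) → p∣ sum f
  p∣-sum {zero}  f h = p∣0
  p∣-sum {suc n} f h = ∣m∣n⇒∣m+n (h zero) (p∣-sum (f ∘ suc) (h ∘ suc))

  p∣-sum-remainder : ∀ {n} (f : Fin n → ℤ) i → (∀ j → j ≢ i → p∣ f j) → p∣ sum f → p∣ f i
  p∣-sum-remainder f zero    h s =
    subst p∣_ (lemma (f zero) (sum (f ∘ suc))) (∣m∣n⇒∣m-n s (p∣-sum (f ∘ suc) (λ j → h (suc j) λ ())))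
    where
    lemma : ∀ a b → a + b - b ≡ a
    lemma = solve-∀
  p∣-sum-remainder f (suc i) h s =
    p∣-sum-remainder (f ∘ suc) i (λ j j≢i → h (suc j) (λ { refl → j≢i refl }))
      (∣m+n∣m⇒∣n s (h zero λ ()))

  _≈_ : ℤ → ℤ → Set
  a ≈ b = p∣ (a - b)

  ≈-refl : ∀ {a} → a ≈ a
  ≈-refl {a} = subst p∣_ (sym (+-inverseʳ a)) p∣0

  ≈-sym : ∀ {a b} → a ≈ b → b ≈ a
  ≈-sym {a} {b} h = subst p∣_ (lemma a b) (∣m⇒∣-m h)
    where
    lemma : ∀ a b → - (a - b) ≡ b - a
    lemma = solve-∀

  ≈-trans : ∀ {a b c} → a ≈ b → b ≈ c → a ≈ c
  ≈-trans {a} {b} {c} h k = subst p∣_ (lemma a b c) (∣m∣n⇒∣m+n h k)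
    where
    lemma : ∀ a b c → (a - b) + (b - c) ≡ a - c
    lemma = solve-∀

  ≈-+ : ∀ {a b c d} → a ≈ b → c ≈ d → a + c ≈ b + d
  ≈-+ {a} {b} {c} {d} h k = subst p∣_ (lemma a b c d) (∣m∣n⇒∣m+n h k)
    where
    lemma : ∀ a b c d → (a - b) + (c - d) ≡ a + c - (b + d)
    lemma = solve-∀

  p∣-resp-≈ : ∀ {a b} → a ≈ b → p∣ a → p∣ b
  p∣-resp-≈ {a} {b} h k = subst p∣_ (lemma a b) (∣m∣n⇒∣m-n k h)
    where
    lemma : ∀ a b → a - (a - b) ≡ b
    lemma = solve-∀

  -- Linear algebra modulo the prime.

  eliminate : ∀ {n} (c m x : Fin n → ℤ) u y →
    - sum (λ k → c k * m k) * y + sum (λ k → u * c k * x k) ≡ sum (λ k → c k * (u * x k - m k * y))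
  eliminate {zero}  c m x u y = refl
  eliminate {suc n} c m x u y = trans
    (lemma (c zero) (m zero) (x zero) u y (sum (λ k → c (suc k) * m (suc k))) (sum (λ k → u * c (suc k) * x (suc k))))
    (cong (λ z → c zero * (u * x zero - m zero * y) + z) (eliminate (c ∘ suc) (m ∘ suc) (x ∘ suc) u y))
    where
    lemma : ∀ c m x u y S T → - (c * m + S) * y + (u * c * x + T) ≡
                              c * (u * x - m * y) + (- S * y + T)
    lemma = solve-∀

  -- Gaussian elimination without division, by induction on the number of columns. Rows are
  -- cross-multiplied with a pivot `u` prime to `p`, so a coefficient that is nonzero mod `p` stays
  -- so after scaling by `u`.
  dependence : ∀ b a (M : Fin a → Fin b → ℤ) → b ℕ.< a →
    Σ (Fin a → ℤ) λ c → (∃ λ i → p∤ c i) × (∀ j → p∣ sum (λ i → c i * M i j))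
  dependence zero    (suc a) M _ = (λ _ → + 1) , (zero , p∤1) , λ ()
  dependence (suc b) (suc a) M (s≤s b<a) with any? (λ j → ¬? (+ p ∣? M zero j))
  -- The first row vanishes mod `p` and is a dependence by itself.
  ... | no none = c , (zero , p∤1) , λ j →
        ∣m∣n⇒∣m+n (∣n⇒∣m*n (+ 1) (decidable-stable (+ p ∣? M zero j) (λ p∤ → none (j , p∤))))
                  (p∣-sum (λ i → + 0 * M (suc i) j) (λ i → p∣0))
    where
    c : Fin (suc a) → ℤ
    c zero    = + 1
    c (suc _) = + 0
  ... | yes (j₀ , p∤u) = c , (suc i , p∤-* u (c′ i) p∤u p∤c′i) , column
    where
    u  = M zero j₀
    M′ = λ k j → u * M (suc k) (punchIn j₀ j) - M (suc k) j₀ * M zero (punchIn j₀ j)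
    rec = dependence b a M′ b<a
    c′ = proj₁ rec
    i = proj₁ (proj₁ (proj₂ rec))
    p∤c′i = proj₂ (proj₁ (proj₂ rec))

    c : Fin (suc a) → ℤ
    -- The pivot row gets the coefficient that cancels column `j₀`; by `eliminate`, every column
    -- becomes a combination of the reduced rows.
    c zero    = - sum (λ k → c′ k * M (suc k) j₀)
    c (suc k) = u * c′ k

    reduced : ∀ j → sum (λ i → c i * M i j) ≡ sum (λ k → c′ k * (u * M (suc k) j - M (suc k) j₀ * M zero j))
    reduced j = eliminate c′ (λ k → M (suc k) j₀) (λ k → M (suc k) j) u (M zero j)

    column : ∀ j → p∣ sum (λ i → c i * M i j)
    column j with j₀ ≟ j
    ... | yes refl = subst p∣_ (sym (reduced j₀)) (p∣-sum _ (λ k →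
            subst p∣_ (sym (vanishes (c′ k) u (M (suc k) j₀))) p∣0))
      where
      vanishes : ∀ c u m → c * (u * m - m * u) ≡ + 0
      vanishes = solve-∀
    ... | no j₀≢j = subst (λ j → p∣ sum (λ i → c i * M i j)) (punchIn-punchOut j₀≢j)
            (subst p∣_ (sym (reduced (punchIn j₀ (punchOut j₀≢j)))) (proj₂ (proj₂ rec) (punchOut j₀≢j)))

  Independent : ∀ {N a} → (Fin a → Subset N → ℤ) → Set
  Independent {a = a} F =
    ∀ (c : Fin a → ℤ) → (∀ x → p∣ sum (λ i → c i * F i x)) → ∀ i → p∣ c i

  -- With more functions than monomials, the coefficient vectors are dependent mod `p`, and the same
  -- dependence holds between the functions at every point.
  independent⇒≤dim : ∀ {N} t {a} (F : Fin a → Subset N → ℤ) →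
    (∀ i → Deg t (F i)) → Independent F → a ℕ.≤ dim N t
  independent⇒≤dim {N} t {a} F deg indep with a ℕ.≤? dim N t
  ... | yes a≤dim = a≤dim
  ... | no  a≰dim = contradiction (indep c combination i) p∤ci
    where
    κ = λ i → proj₁ (spanning t (F i) (deg i))
    dep = dependence (dim N t) a κ (ℕₚ.≰⇒> a≰dim)
    c = proj₁ dep
    i = proj₁ (proj₁ (proj₂ dep))
    p∤ci = proj₂ (proj₁ (proj₂ dep))

    regroup : ∀ x → sum (λ j → sum (λ i → c i * κ i j) * basis t x j) ≡ sum (λ i → c i * F i x)
    regroup x = begin
      sum (λ j → sum (λ i → c i * κ i j) * basis t x j)
        ≡⟨ sum-cong-≗ (λ j → *-distribʳ-sum (basis t x j) (λ i → c i * κ i j)) ⟩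
      sum (λ j → sum (λ i → c i * κ i j * basis t x j))
        ≡⟨ ∑-comm (λ j i → c i * κ i j * basis t x j) ⟩
      sum (λ i → sum (λ j → c i * κ i j * basis t x j))
        ≡⟨ sum-cong-≗ (λ i → sum-cong-≗ (λ j → *-assoc (c i) (κ i j) (basis t x j))) ⟩
      sum (λ i → sum (λ j → c i * (κ i j * basis t x j)))
        ≡⟨ sum-cong-≗ (λ i → *-distribˡ-sum (c i) (λ j → κ i j * basis t x j)) ⟨
      sum (λ i → c i * sum (λ j → κ i j * basis t x j))
        ≡⟨ sum-cong-≗ (λ i → cong (c i *_) (proj₂ (spanning t (F i) (deg i)) x)) ⟨
      sum (λ i → c i * F i x) ∎

    combination : ∀ x → p∣ sum (λ i → c i * F i x)
    combination x = subst p∣_ (regroup x)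
      (p∣-sum _ (λ j → ∣m⇒∣m*n (basis t x j) (proj₂ (proj₂ dep) j)))

  -- Setting the first variable to `false` isolates the monomials without it; setting it to `true`
  -- then leaves those with it.
  basis-independent : ∀ {N} t → Independent {N} (λ j x → basis t x j)
  basis-independent {zero} (suc t) c h zero = subst p∣_ (lemma (c zero)) (h [])
    where
    lemma : ∀ c → c * + 1 + + 0 ≡ c
    lemma = solve-∀
  basis-independent {suc N} (suc t) c h j = coefficient (splitAt (dim N (suc t)) j) refl
    where
    cˡ = λ i → c (i ↑ˡ dim N t)
    cʳ = λ i → c (dim N (suc t) ↑ʳ i)
    low  = λ x → sum (λ i → cˡ i * basis (suc t) x i)
    high = λ x → sum (λ i → cʳ i * basis t x i)

    expand : ∀ b x → sum (λ j → c j * basis (suc t) (b ∷ x) j) ≡ low x + + ⟦ b ⟧ * high x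
    expand b x = begin
      sum (λ j → c j * basis (suc t) (b ∷ x) j)
        ≡⟨ sum-++ (dim N (suc t)) (λ j → c j * basis (suc t) (b ∷ x) j) ⟩
      _ ≡⟨ cong₂ _+_ (sum-cong-≗ (λ i → cong (cˡ i *_) (lookup-++ˡ e₀ e₁ i)))
                     (sum-cong-≗ (λ i → trans (cong (cʳ i *_) (lookup-++ʳ e₀ e₁ i))
                                              (lemma (cʳ i) (+ ⟦ b ⟧) (basis t x i)))) ⟩
      low x + sum (λ i → + ⟦ b ⟧ * (cʳ i * basis t x i))
        ≡⟨ cong (λ z → low x + z) (*-distribˡ-sum (+ ⟦ b ⟧) (λ i → cʳ i * basis t x i)) ⟨
      low x + + ⟦ b ⟧ * high x ∎
      where
      e₀ = basis (suc t) x
      e₁ = λ j → + ⟦ b ⟧ * basis t x j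
      lemma : ∀ a b c → a * (b * c) ≡ b * (a * c)
      lemma = solve-∀

    p∣low : ∀ x → p∣ low x
    p∣low x = subst p∣_ (+-identityʳ (low x)) (subst p∣_ (expand false x) (h (false ∷ x)))

    p∣high : ∀ x → p∣ high x
    p∣high x = subst p∣_ (*-identityˡ (high x))
      (∣m+n∣m⇒∣n (subst p∣_ (expand true x) (h (true ∷ x))) (p∣low x))

    coefficient : ∀ s → splitAt (dim N (suc t)) j ≡ s → p∣ c j
    coefficient (inj₁ i) eq =
      subst (λ j → p∣ c j) (splitAt⁻¹-↑ˡ eq) (basis-independent (suc t) cˡ p∣low i)
    coefficient (inj₂ i) eq =
      subst (λ j → p∣ c j) (splitAt⁻¹-↑ʳ eq) (basis-independent t cʳ p∣high i)

  -- Counting roots modulo the prime.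

  Incongruent : ℕ → ℕ → Set
  Incongruent a b = p∤ + b - + a

  -- Lagrange's argument: divide by `t - a` at the first root. At any other listed root `b` the
  -- factor `b - a` is prime to `p`, so the quotient vanishes there.
  roots : ∀ e f → Poly e f → ∀ ts → e ℕ.≤ length ts → AllPairs Incongruent ts →
          All (λ t → p∣ f t) ts → ∀ t → p∣ f t
  roots zero    f h _ _ _ _ t = subst p∣_ (sym (h t)) p∣0
  roots (suc e) f h (a ∷ ts) (s≤s e≤) (a≁ts ∷ distinct) (p∣fa ∷ p∣f) t with h a
  ... | q , hq , eq = subst p∣_ (sym (eq t)) (∣m∣n⇒∣m+n p∣fa (∣n⇒∣m*n (+ t - + a) (p∣q t)))
    where
    p∣q : ∀ t → p∣ q t
    p∣q = roots e q hq ts e≤ distinct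
      (All.zipWith (λ { {b} (a≁b , p∣fb) → p∣-cancelˡ (+ b - + a) (q b) a≁b
                         (∣m+n∣m⇒∣n (subst p∣_ (eq b) p∣fb) p∣fa) }) (a≁ts , p∣f))

  -- As a polynomial in `t`, a Newton series has rational coefficients. The multiplier `u` is the
  -- product of the factorials of its indices, all below `p`, hence prime to `p`.
  newton-poly : ∀ cs j → j ℕ.+ length cs ℕ.≤ p →
    Σ ℤ λ u → p∤ u × Poly (j ℕ.+ length cs) (λ t → u * newton cs j t)
  newton-poly []       j _ = + 1 , p∤1 , Poly-zero (j ℕ.+ 0)
  newton-poly (c ∷ cs) j j+≤p with newton-poly cs (suc j) (subst (ℕ._≤ p) (ℕₚ.+-suc j (length cs)) j+≤p)
  ... | u , p∤u , hu =
    + (j !) * u ,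
    p∤-* (+ (j !)) u (p∤-! j (ℕₚ.≤-trans (ℕₚ.m<m+n j (s≤s z≤n)) j+≤p)) p∤u ,
    Poly-cong (j ℕ.+ suc (length cs)) (λ t → lemma (+ (j !)) u c (binom t j) (newton cs (suc j) t))
      (Poly-+ _ (Poly-mono (ℕₚ.m<m+n j (s≤s z≤n)) (Poly-scale (suc j) (u * c) (Poly-binom j)))
                (Poly-scale _ (+ (j !)) (subst (λ e → Poly e (λ t → u * newton cs (suc j) t)) (sym (ℕₚ.+-suc j (length cs))) hu)))
    where
    lemma : ∀ v u c b n → u * c * (v * b) + v * (u * n) ≡ v * u * (c * b + n)
    lemma = solve-∀

  newton-roots : ∀ cs → length cs ℕ.≤ p → ∀ ts → length cs ℕ.≤ length ts → AllPairs Incongruent ts →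
                 All (λ t → p∣ newton cs 0 t) ts → ∀ t → p∣ newton cs 0 t
  newton-roots cs ≤p ts ≤ts distinct p∣ts t with newton-poly cs 0 ≤p
  ... | u , p∤u , hu = p∣-cancelˡ u (newton cs 0 t) p∤u
    (roots (length cs) _ hu ts ≤ts distinct (All.map (∣n⇒∣m*n u) p∣ts) t)

  -- Functions on the cube that are invariant under permuting coordinates

  -- The point of layer `t` whose `true` entries come first; for `t` above `N` it is the full set.
  sorted : ∀ N → ℕ → Subset N
  sorted zero    t       = []
  sorted (suc N) zero    = false ∷ sorted N zero
  sorted (suc N) (suc t) = true ∷ sorted N t

  ∣sorted∣ : ∀ N t → t ℕ.≤ N → ∣ sorted N t ∣ ≡ t
  ∣sorted∣ zero    zero    _         = refl
  ∣sorted∣ (suc N) zero    _         = ∣sorted∣ N zero z≤n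
  ∣sorted∣ (suc N) (suc t) (s≤s t≤N) = cong suc (∣sorted∣ N t t≤N)

  -- D k F compares F on the two points that differ by swapping unequal entries k and k+1;
  -- the remaining coordinates are the arguments.
  D : ∀ {N} → Fin (suc N) → (Subset (suc (suc N)) → ℤ) → Subset N → ℤ
  D         zero    F w       = F (true ∷ false ∷ w) - F (false ∷ true ∷ w)
  D {suc N} (suc k) F (b ∷ w) = D k (at b F) w

  D-sub : ∀ {N} k (F G : Subset (suc (suc N)) → ℤ) w → D k F w - D k G w ≡ D k (λ x → F x - G x) w
  D-sub zero F G w = lemma (F (true ∷ false ∷ w)) (F (false ∷ true ∷ w)) (G (true ∷ false ∷ w)) (G (false ∷ true ∷ w))
    where
    lemma : ∀ a b c d → (a - b) - (c - d) ≡ (a - c) - (b - d)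
    lemma = solve-∀
  D-sub {suc N} (suc k) F G (b ∷ w) = D-sub k (at b F) (at b G) w

  Deg-at-false : ∀ {N} t {F : Subset (suc N) → ℤ} → Deg t F → Deg t (at false F)
  Deg-at-false zero    d x = d (false ∷ x)
  Deg-at-false (suc t) d = proj₁ d

  Deg-at-true : ∀ {N} t {F : Subset (suc N) → ℤ} → Deg (suc t) F → Deg (suc t) (at true F)
  Deg-at-true t {F} (d₀ , d₁) = Deg-cong (suc t) (λ x → lemma (F (false ∷ x)) (F (true ∷ x)))
    (Deg-+ (suc t) d₀ (Deg-suc t d₁))
    where
    lemma : ∀ a b → a + (b - a) ≡ b
    lemma = solve-∀

  -- Subtracting the common corner `F (false ∷ false ∷ w)` from both values turns the swap
  -- difference into a difference of two first-order differences, each of lower degree.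
  Deg-D : ∀ {N} t k {F : Subset (suc (suc N)) → ℤ} → Deg (suc t) F → Deg t (D k F)
  Deg-D t zero {F} (d₀ , d₁) =
    Deg-cong t (λ w → lemma (F (true ∷ false ∷ w)) (F (false ∷ false ∷ w)) (F (false ∷ true ∷ w)))
      (Deg-sub t (Deg-at-false t d₁) (proj₂ d₀))
    where
    lemma : ∀ a b c → (a - b) - (c - b) ≡ a - c
    lemma = solve-∀
  Deg-D {suc N} zero    (suc k) d (false ∷ w) = Deg-D 0 k (proj₁ d) w
  Deg-D {suc N} zero    (suc k) {F} d (true ∷ w)  = Deg-D 0 k (Deg-at-true 0 {F} d) w
  Deg-D {suc N} (suc t) (suc k) {F} (d₀ , d₁) =
    Deg-D (suc t) k d₀ ,
    Deg-cong t (λ w → sym (D-sub k (at true F) (at false F) w)) (Deg-D t k d₁)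

  -- Both swapped points have one `true` more than `w`. The predicate `Q` varies because passing a
  -- `true` entry shifts the layer by one.
  D-vanishes : ∀ {N} (Q : ℕ → Set) k (F : Subset (suc (suc N)) → ℤ) →
    (∀ x → Q ∣ x ∣ → p∣ F x) → ∀ w → Q (suc ∣ w ∣) → p∣ D k F w
  D-vanishes Q zero F h w q = ∣m∣n⇒∣m-n (h (true ∷ false ∷ w) q) (h (false ∷ true ∷ w) q)
  D-vanishes {suc N} Q (suc k) F h (false ∷ w) q = D-vanishes Q k (at false F) (λ x → h (false ∷ x)) w q
  D-vanishes {suc N} Q (suc k) F h (true ∷ w)  q = D-vanishes (Q ∘ suc) k (at true F) (λ x → h (true ∷ x)) w q

  SwapInvariant : ∀ {N} → (Subset N → ℤ) → Set
  SwapInvariant {zero}        F = ⊤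
  SwapInvariant {suc zero}    F = ⊤
  SwapInvariant {suc (suc N)} F = ∀ k w → p∣ D k F w

  SwapInvariant-at : ∀ {N} b (F : Subset (suc N) → ℤ) → SwapInvariant F → SwapInvariant (at b F)
  SwapInvariant-at {zero}        b F h = tt
  SwapInvariant-at {suc zero}    b F h = tt
  SwapInvariant-at {suc (suc N)} b F h = λ k w → h (suc k) (b ∷ w)

  -- Adjacent swaps move the leading `false` past the `true` entries, as in insertion sort.
  sorted-insert : ∀ N (F : Subset (suc N) → ℤ) → SwapInvariant F → ∀ t → t ℕ.≤ N →
                  F (false ∷ sorted N t) ≈ F (sorted (suc N) t)
  sorted-insert N       F h zero    _         = ≈-refl {F (false ∷ sorted N 0)}
  sorted-insert (suc N) F h (suc t) (s≤s t≤N) =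
    ≈-trans {F (false ∷ true ∷ sorted N t)} {F (true ∷ false ∷ sorted N t)}
      (≈-sym {F (true ∷ false ∷ sorted N t)} (h zero (sorted N t)))
      (sorted-insert N (at true F) (SwapInvariant-at true F h) t t≤N)

  ≈-sorted : ∀ N (F : Subset N → ℤ) → SwapInvariant F → ∀ x → F x ≈ F (sorted N ∣ x ∣)
  ≈-sorted zero    F h []          = ≈-refl {F []}
  ≈-sorted (suc N) F h (true  ∷ x) = ≈-sorted N (at true F) (SwapInvariant-at true F h) x
  ≈-sorted (suc N) F h (false ∷ x) =
    ≈-trans {F (false ∷ x)} {F (false ∷ sorted N ∣ x ∣)}
      (≈-sorted N (at false F) (SwapInvariant-at false F h) x)
      (sorted-insert N F h ∣ x ∣ (∣p∣≤n x))

  Symmetric : ∀ {N} → (Subset N → ℤ) → Set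
  Symmetric F = ∀ x y → ∣ x ∣ ≡ ∣ y ∣ → F x ≈ F y

  swapInvariant⇒symmetric : ∀ {N} (F : Subset N → ℤ) → SwapInvariant F → Symmetric F
  swapInvariant⇒symmetric {N} F h x y ∣x∣≡∣y∣ =
    ≈-trans {F x} {F (sorted N ∣ x ∣)} (≈-sorted N F h x)
      (subst (λ t → F (sorted N t) ≈ F y) (sym ∣x∣≡∣y∣) (≈-sym {F y} (≈-sorted N F h y)))

  -- Newton interpolation: `Δ F` is again symmetric, with a smaller degree bound, and its
  -- coefficients are those of `F` after the constant term, which is the value on layer 0.
  symmetric⇒newton : ∀ {N} e (F : Subset N → ℤ) → Deg e F → Symmetric F →
    Σ (List ℤ) λ cs → length cs ℕ.≤ e × (∀ x → F x ≈ newton cs 0 ∣ x ∣)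
  symmetric⇒newton zero F d h = [] , z≤n , λ x → subst (_≈ + 0) (sym (d x)) p∣0
  symmetric⇒newton {zero} (suc e) F d h = F [] ∷ [] , s≤s z≤n , λ { [] → subst (F [] ≈_) (lemma (F [])) (≈-refl {F []}) }
    where
    lemma : ∀ a → a ≡ a * + 1 + + 0
    lemma = solve-∀
  symmetric⇒newton {suc N} (suc e) F (d₀ , d₁) h
    with symmetric⇒newton e (Δ F) d₁ (λ x y eq →
           subst p∣_ (lemma (F (true ∷ x)) (F (false ∷ x)) (F (true ∷ y)) (F (false ∷ y)))
             (∣m∣n⇒∣m-n (h (true ∷ x) (true ∷ y) (cong suc eq)) (h (false ∷ x) (false ∷ y) eq)))
    where
    lemma : ∀ a b c d → (a - c) - (b - d) ≡ (a - b) - (c - d)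
    lemma = solve-∀
  ... | cs , cs≤e , hcs = c₀ ∷ cs , s≤s cs≤e , λ x →
    ≈-trans {F x} {F (sorted (suc N) ∣ x ∣)}
      (h x (sorted (suc N) ∣ x ∣) (sym (∣sorted∣ (suc N) ∣ x ∣ (∣p∣≤n x))))
      (on-sorted ∣ x ∣ (∣p∣≤n x))
    where
    c₀ = F (sorted (suc N) 0)

    on-sorted : ∀ t → t ℕ.≤ suc N → F (sorted (suc N) t) ≈ newton (c₀ ∷ cs) 0 t
    on-sorted zero _ = subst (c₀ ≈_)
      (trans (lemma c₀) (cong (λ z → c₀ * + 1 + z) (sym (newton-at-0 cs 0)))) (≈-refl {c₀})
      where
      lemma : ∀ a → a ≡ a * + 1 + + 0
      lemma = solve-∀
    -- Layer `suc t` is reached from layer `t` by adding `Δ F y` to `F (false ∷ y)`, in parallel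
    -- with `newton-step`.
    on-sorted (suc t) (s≤s t≤N) =
      subst₂ _≈_ (lemma (F (false ∷ y)) (F (true ∷ y)))
                 (trans (lemma₂ (c₀ * + 1) (newton cs 1 t) (newton cs 0 t))
                        (cong (λ z → c₀ * + 1 + z) (sym (newton-step cs 0 t))))
        (≈-+ {F (false ∷ y)} {newton (c₀ ∷ cs) 0 t} {Δ F y} {newton cs 0 t}
          (≈-trans {F (false ∷ y)} {F (sorted (suc N) t)}
            (h (false ∷ y) (sorted (suc N) t) (trans ∣y∣ (sym (∣sorted∣ (suc N) t t≤1+N))))
            (on-sorted t t≤1+N))
          (subst (λ z → Δ F y ≈ newton cs 0 z) ∣y∣ (hcs y)))
      where
      y = sorted N t
      ∣y∣ = ∣sorted∣ N t t≤N
      t≤1+N = ℕₚ.m≤n⇒m≤1+n t≤N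
      lemma : ∀ a b → a + (b - a) ≡ b
      lemma = solve-∀
      lemma₂ : ∀ a b c → (a + b) + c ≡ a + (c + b)
      lemma₂ = solve-∀

  -- A witness that a polynomial of degree < e in the layer number cannot vanish mod p on
  -- the good layers among i, …, i + N without vanishing on all of them.
  Enough : (ℕ → Set) → ℕ → ℕ → ℕ → Set
  Enough Good N i e =
    (∀ t → t ℕ.≤ N → Good (i ℕ.+ t)) ⊎
    (Σ (List ℕ) λ ts → e ℕ.≤ length ts × AllPairs Incongruent ts ×
                       All (λ t → t ℕ.≤ N × Good (i ℕ.+ t)) ts)

  -- In the second case of `Enough`, a Newton series with at most `e` terms has at least `e`
  -- incongruent roots; `e ≤ p` keeps the factorials prime to `p`.
  symmetric-vanishes : ∀ {N} Good i e → e ℕ.≤ p → Enough Good N i e →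
    (F : Subset N → ℤ) → Deg e F → Symmetric F →
    (∀ x → Good (i ℕ.+ ∣ x ∣) → p∣ F x) → ∀ x → p∣ F x
  symmetric-vanishes Good i e e≤p (inj₁ all-good) F d h vanish x = vanish x (all-good ∣ x ∣ (∣p∣≤n x))
  symmetric-vanishes {N} Good i e e≤p (inj₂ (ts , e≤ts , distinct , good)) F d h vanish x
    with symmetric⇒newton e F d h
  ... | cs , cs≤e , hcs = p∣-resp-≈ {newton cs 0 ∣ x ∣} (≈-sym {F x} (hcs x))
    (newton-roots cs (ℕₚ.≤-trans cs≤e e≤p) ts (ℕₚ.≤-trans cs≤e e≤ts) distinct
      (All.map (λ { {t} (t≤N , good-t) → root t t≤N good-t }) good) ∣ x ∣)
    where
    root : ∀ t → t ℕ.≤ N → Good (i ℕ.+ t) → p∣ newton cs 0 t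
    root t t≤N good-t = subst (λ z → p∣ newton cs 0 z) ∣y∣
      (p∣-resp-≈ {F y} (hcs y) (vanish y (subst (λ z → Good (i ℕ.+ z)) (sym ∣y∣) good-t)))
      where
      y = sorted N t
      ∣y∣ = ∣sorted∣ N t t≤N

  -- Each difference D k lowers N by 2 and the degree by 1, and moves layer t to layer t − 1;
  -- when all of them vanish, F is a polynomial in ∣ x ∣.
  vanishes : ∀ (Good : ℕ → Set) N₀ e → e ℕ.≤ p →
    (∀ i N → N ℕ.+ (i ℕ.+ i) ≡ N₀ → Enough Good N i (e ℕ.∸ i)) →
    ∀ N i → N ℕ.+ (i ℕ.+ i) ≡ N₀ → (F : Subset N → ℤ) → Deg (e ℕ.∸ i) F →
    (∀ x → Good (i ℕ.+ ∣ x ∣) → p∣ F x) → ∀ x → p∣ F x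
  vanishes Good N₀ e e≤p enough N i eq F d vanish =
    symmetric-vanishes Good i (e ℕ.∸ i) (ℕₚ.≤-trans (ℕₚ.m∸n≤m e i) e≤p) (enough i N eq) F d
      (swapInvariant⇒symmetric F (invariant N eq F d vanish)) vanish
    where
    Deg-D-pred : ∀ {N} t k {F : Subset (suc (suc N)) → ℤ} → Deg t F → Deg (ℕ.pred t) (D k F)
    Deg-D-pred zero    k d = Deg-D 0 k (Deg-suc 0 d)
    Deg-D-pred (suc t) k d = Deg-D t k d

    invariant : ∀ N → N ℕ.+ (i ℕ.+ i) ≡ N₀ → (F : Subset N → ℤ) → Deg (e ℕ.∸ i) F →
                (∀ x → Good (i ℕ.+ ∣ x ∣) → p∣ F x) → SwapInvariant F
    invariant zero          eq F d vanish = tt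
    invariant (suc zero)    eq F d vanish = tt
    invariant (suc (suc N)) eq F d vanish k =
      vanishes Good N₀ e e≤p enough N (suc i) (trans shift eq) (D k F)
        (subst (λ t → Deg t (D k F)) (ℕₚ.pred[m∸n]≡m∸[1+n] e i) (Deg-D-pred (e ℕ.∸ i) k d))
        (λ w good → D-vanishes (λ t → Good (i ℕ.+ t)) k F vanish w
          (subst Good (sym (ℕₚ.+-suc i ∣ w ∣)) good))
      where
      shift : N ℕ.+ (suc i ℕ.+ suc i) ≡ suc (suc N) ℕ.+ (i ℕ.+ i)
      shift = trans (ℕₚ.+-suc N (i ℕ.+ suc i))
        (cong suc (trans (cong (N ℕ.+_) (ℕₚ.+-suc i i)) (ℕₚ.+-suc N (i ℕ.+ i))))

-- Dimensions as binomial sums, and bounds on lists of numbers.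

module Counting where
  open CubeFunctions using (dim)
  open import Data.Fin using (zero; suc; fromℕ<)
  open import Data.Fin.Properties using (injective⇒≤; fromℕ<-injective)
  open import Data.List using (List; []; _∷_; length; lookup)
  open import Data.List.Membership.Propositional.Properties using (∈-lookup)
  open import Data.List.Relation.Unary.All as All using (All; []; _∷_)
  open import Data.List.Relation.Unary.AllPairs using ([]; _∷_)
  open import Data.List.Relation.Unary.Unique.Propositional using (Unique)
  open import Data.Nat using (zero; suc; _+_; _∸_; _≤_; _<_; _≤?_; z≤n; s≤s)
  open import Data.Nat.Combinatorics using (_C_; nCn≡1; nCk≡nC[n∸k]; k>n⇒nCk≡0; nCk+nC[k+1]≡[n+1]C[k+1])
  open import Data.Nat.Properties
  open import Data.Nat.Tactic.RingSolver using (solve-∀)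
  open import Relation.Binary.PropositionalEquality
  open import Relation.Nullary using (yes; no; contradiction)
  open ≡-Reasoning

  -- The extra monomials are those of degree exactly `t`.
  dim-suc : ∀ N t → dim N (suc t) ≡ dim N t + N C t
  dim-suc zero    zero    = refl
  dim-suc zero    (suc t) = cong suc (sym (k>n⇒nCk≡0 {0} {suc t} (s≤s z≤n)))
  dim-suc (suc N) zero    = begin
    dim N 1 + 0  ≡⟨ +-identityʳ (dim N 1) ⟩
    dim N 1      ≡⟨ dim-suc N 0 ⟩
    N C 0        ≡⟨ nC0≡1 N ⟩
    1            ≡⟨ nC0≡1 (suc N) ⟨
    suc N C 0    ∎
    where
    nC0≡1 : ∀ n → n C 0 ≡ 1
    nC0≡1 n = trans (nCk≡nC[n∸k] {k = 0} {n = n} z≤n) (nCn≡1 n)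
  dim-suc (suc N) (suc t) = begin
    dim N (suc (suc t)) + dim N (suc t)
      ≡⟨ cong₂ _+_ (dim-suc N (suc t)) (dim-suc N t) ⟩
    (dim N (suc t) + N C suc t) + (dim N t + N C t)
      ≡⟨ lemma (dim N (suc t)) (N C suc t) (dim N t) (N C t) ⟩
    (dim N (suc t) + dim N t) + (N C t + N C suc t)
      ≡⟨ cong (λ z → (dim N (suc t) + dim N t) + z) (nCk+nC[k+1]≡[n+1]C[k+1] N t) ⟩
    (dim N (suc t) + dim N t) + suc N C suc t ∎
    where
    lemma : ∀ a b c d → (a + b) + (c + d) ≡ (a + c) + (d + b)
    lemma = solve-∀

  -- Telescoping of `dim-suc`: the sum counts the monomials of degree from `s - t + 1` to `s`. For
  -- `t > s`, truncated subtraction agrees with the zero convention of `binomShift`.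
  binomSum-dim : ∀ N s t → binomSum N s t + dim N (suc s ∸ t) ≡ dim N (suc s)
  binomSum-dim N s zero    = refl
  binomSum-dim N s (suc t) = begin
    binomSum N s t + binomShift N s t + dim N (s ∸ t)    ≡⟨ +-assoc (binomSum N s t) _ _ ⟩
    binomSum N s t + (binomShift N s t + dim N (s ∸ t))  ≡⟨ cong (binomSum N s t +_) shift ⟩
    binomSum N s t + dim N (suc s ∸ t)                   ≡⟨ binomSum-dim N s t ⟩
    dim N (suc s)                                        ∎
    where
    shift : binomShift N s t + dim N (s ∸ t) ≡ dim N (suc s ∸ t)
    shift with t ≤? s
    ... | yes t≤s rewrite +-∸-assoc 1 t≤s = trans (+-comm (N C (s ∸ t)) _) (sym (dim-suc N (s ∸ t)))
    ... | no  t≰s rewrite m≤n⇒m∸n≡0 (≰⇒> t≰s) | m≤n⇒m∸n≡0 (<⇒≤ (≰⇒> t≰s)) = refl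

  unique<⇒length≤ : ∀ {p} (xs : List ℕ) → Unique xs → All (_< p) xs → length xs ≤ p
  unique<⇒length≤ {p} xs unique all< = injective⇒≤ {f = λ i → fromℕ< (bound i)}
    (λ {i} {j} eq → lookup-injective unique i j (fromℕ<-injective _ _ (bound i) (bound j) eq))
    where
    bound : ∀ i → lookup xs i < p
    bound i = All.lookup all< (∈-lookup {xs = xs} i)

    lookup-injective : ∀ {xs : List ℕ} → Unique xs → ∀ i j → lookup xs i ≡ lookup xs j → i ≡ j
    lookup-injective (x∉xs ∷ u) zero    zero    eq = refl
    lookup-injective (x∉xs ∷ u) zero    (suc j) eq = contradiction eq (All.lookup x∉xs (∈-lookup j))
    lookup-injective (x∉xs ∷ u) (suc i) zero    eq = contradiction (sym eq) (All.lookup x∉xs (∈-lookup i))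
    lookup-injective (x∉xs ∷ u) (suc i) (suc j) eq = cong suc (lookup-injective u i j eq)

  ≤maxList : ∀ xs → All (_≤ maxList xs) xs
  ≤maxList []       = []
  ≤maxList (x ∷ xs) = m≤m⊔n x _ ∷ All.map (λ y≤ → ≤-trans y≤ (m≤n⊔m x _)) (≤maxList xs)

-- Supply of good layers.

module Layers (p : ℕ) (p-prime : Prime p) (K : List ℕ) where
  open Modular p p-prime
  open Counting
  open import Data.Integer as ℤ using (+_)
  open import Data.Integer.Divisibility.Signed using (_∣?_; ∣m∣n⇒∣m-n)
  import Data.Integer.Tactic.RingSolver as ℤ-solver
  open import Data.List using (List; []; _∷_; length; applyUpTo)
  open import Data.List.Properties using (length-applyUpTo)
  open import Data.List.Relation.Binary.Sublist.Propositional using (_⊆_; []; _∷_; _∷ʳ_; ⊆-refl; ⊆-trans)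
  open import Data.List.Relation.Binary.Sublist.Propositional.Properties using (All-resp-⊆)
  open import Data.List.Relation.Unary.All as All using (All; []; _∷_)
  import Data.List.Relation.Unary.All.Properties as Allₚ
  open import Data.List.Relation.Unary.AllPairs using (AllPairs; []; _∷_)
  import Data.List.Relation.Unary.AllPairs.Properties as AllPairsₚ
  open import Data.Nat using (suc; _+_; _*_; _∸_; _≤_; _<_; _≤?_; z≤n; s≤s; z<s; s≤s⁻¹)
  open import Data.Nat.Properties
  open import Data.Nat.Tactic.RingSolver using (solve-∀)
  open import Data.Product using (Σ; _×_; _,_)
  open import Data.Sum using (inj₁; inj₂)
  open import Function using (_∘_; id)
  open import Relation.Binary.PropositionalEquality
  open import Relation.Nullary using (¬_; Dec; yes; no)

  -- The bad layers are those met by a member of the family after the first coordinate is dropped.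
  Good : ℕ → Set
  Good t = All (λ k → p∤ (+ t ℤ.- + k) × p∤ (+ suc t ℤ.- + k)) K

  -- Both differences lie strictly between 0 and `p`.
  Good-above : ∀ {t} → maxList K < t → suc t < p → Good t
  Good-above max<t t<p = All.map
    (λ k≤ → p∤difference (≤-<-trans k≤ max<t) (<-trans (n<1+n _) t<p) ,
            p∤difference (<-trans (≤-<-trans k≤ max<t) (n<1+n _)) t<p) (≤maxList K)

  AllPairs-resp-⊆ : ∀ {R : ℕ → ℕ → Set} {xs ys} → xs ⊆ ys → AllPairs R ys → AllPairs R xs
  AllPairs-resp-⊆ []         []       = []
  AllPairs-resp-⊆ (_ ∷ʳ s)   (r ∷ rs) = AllPairs-resp-⊆ s rs
  AllPairs-resp-⊆ (refl ∷ s) (r ∷ rs) = All-resp-⊆ s r ∷ AllPairs-resp-⊆ s rs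

  -- No two members of `B` are incongruent, so a pairwise incongruent list meets `B` at most once.
  remove-class : ∀ {B : ℕ → Set} → (∀ t → Dec (B t)) → (∀ {a b} → B a → B b → ¬ Incongruent a b) →
    ∀ ts → AllPairs Incongruent ts →
    Σ (List ℕ) λ us → us ⊆ ts × length ts ≤ suc (length us) × All (λ t → ¬ B t) us
  remove-class B? one []       []       = [] , [] , z≤n , []
  remove-class B? one (t ∷ ts) (r ∷ rs) with B? t
  ... | yes Bt = ts , t ∷ʳ ⊆-refl , ≤-refl , All.map (λ inc Bu → one Bt Bu inc) r
  ... | no ¬Bt with remove-class B? one ts rs
  ...   | us , us⊆ts , len , ¬Bus = t ∷ us , refl ∷ us⊆ts , s≤s len , ¬Bt ∷ ¬Bus

  remove-residue : ∀ i k ts → AllPairs Incongruent ts →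
    Σ (List ℕ) λ us → us ⊆ ts × length ts ≤ suc (length us) × All (λ t → p∤ (+ (i + t) ℤ.- + k)) us
  remove-residue i k = remove-class (λ t → + p ∣? (+ (i + t) ℤ.- + k))
    (λ {a} {b} p∣a p∣b inc → inc (subst p∣_ (lemma (+ i) (+ a) (+ b) (+ k)) (∣m∣n⇒∣m-n p∣b p∣a)))
    where
    lemma : ∀ i a b k → ((i ℤ.+ b) ℤ.- k) ℤ.- ((i ℤ.+ a) ℤ.- k) ≡ b ℤ.- a
    lemma = ℤ-solver.solve-∀

  -- Each `k` spoils only the residue classes of `k - i` and `k - i - 1`, and each class costs at
  -- most one point.
  good-points : ∀ i ts → AllPairs Incongruent ts →
    Σ (List ℕ) λ us → us ⊆ ts × length ts ≤ 2 * length K + length us × All (Good ∘ (λ t → i + t)) us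
  good-points i ts rs = go K
    where
    go : ∀ K → Σ (List ℕ) λ us → us ⊆ ts × length ts ≤ 2 * length K + length us ×
           All (λ t → All (λ k → p∤ (+ (i + t) ℤ.- + k) × p∤ (+ suc (i + t) ℤ.- + k)) K) us
    go [] = ts , ⊆-refl , ≤-refl , All.universal (λ _ → []) ts
    go (k ∷ K) with go K
    ... | us , us⊆ts , len , good with remove-residue i k us (AllPairs-resp-⊆ us⊆ts rs)
    ... | vs , vs⊆us , len′ , good′ with remove-residue (suc i) k vs (AllPairs-resp-⊆ (⊆-trans vs⊆us us⊆ts) rs)
    ... | ws , ws⊆vs , len″ , good″ =
      ws , ⊆-trans ws⊆vs (⊆-trans vs⊆us us⊆ts) , total ,
      All.zipWith (λ { (pq , gs) → pq ∷ gs })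
        (All.zip (All-resp-⊆ ws⊆vs good′ , good″) , All-resp-⊆ (⊆-trans ws⊆vs vs⊆us) good)
      where
      open ≤-Reasoning
      rearrange : ∀ k w → 2 * k + suc (suc w) ≡ 2 * suc k + w
      rearrange = solve-∀
      total : length ts ≤ 2 * suc (length K) + length ws
      total = begin
        length ts                                ≤⟨ len ⟩
        2 * length K + length us                 ≤⟨ +-monoʳ-≤ (2 * length K) (≤-trans len′ (s≤s len″)) ⟩
        2 * length K + suc (suc (length ws))     ≡⟨ rearrange (length K) (length ws) ⟩
        2 * suc (length K) + length ws           ∎

  module _ (s N₀ : ℕ) (s+r≤p : s + length K ≤ p) (0<r : 0 < length K)
           (s+max≤ : s + maxList K ≤ suc N₀) where

    r = length K

    s<p : s < p
    s<p = ≤-trans (≤-trans (≤-reflexive (+-comm 1 s)) (+-monoʳ-≤ s 0<r)) s+r≤p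

    -- For i ≤ N₀ − s the window i, …, N₀ − i is long enough to afford the loss of 2r residue
    -- classes; beyond that it lies above max K and below p − 1, apart from its first layer.
    enough : ∀ i N → N + (i + i) ≡ N₀ → Enough Good N i (suc s ∸ 2 * r ∸ i)
    enough i N eq with p ≤? suc N
    -- The window contains a full residue system; at least `p - 2r` of its points are good, and
    -- `s < p`.
    ... | yes p≤1+N with good-points i (applyUpTo id p) (AllPairsₚ.applyUpTo⁺₁ id p p∤difference)
    ...   | us , us⊆ , len , good = inj₂
      ( us
      , ≤-trans (m∸n≤m (suc s ∸ 2 * r) i) (m≤n+o⇒m∸n≤o (suc s) (2 * r)
          (≤-trans s<p (subst (_≤ 2 * r + length us) (length-applyUpTo id p) len)))
      , AllPairs-resp-⊆ us⊆ (AllPairsₚ.applyUpTo⁺₁ id p p∤difference)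
      , All.zip (All-resp-⊆ us⊆ (Allₚ.applyUpTo⁺₁ id p (λ t<p → s≤s⁻¹ (≤-trans t<p p≤1+N))) , good))
    enough i N eq | no p≰1+N with s + i ≤? N₀
    -- All `N + 1` offsets are incongruent here, and `s ≤ N + i` leaves at least `s + 1 - 2r - i`
    -- good ones.
    ... | yes s+i≤N₀ with good-points i (applyUpTo id (suc N))
                            (AllPairsₚ.applyUpTo⁺₁ id (suc N) (λ a<b b≤N → p∤difference a<b (<-trans b≤N (≰⇒> p≰1+N))))
    ...   | us , us⊆ , len , good = inj₂
      ( us
      , subst (_≤ length us) (sym (∸-+-assoc (suc s) (2 * r) i)) (m≤n+o⇒m∸n≤o (suc s) (2 * r + i) bound)
      , AllPairs-resp-⊆ us⊆ (AllPairsₚ.applyUpTo⁺₁ id (suc N) (λ a<b b≤N → p∤difference a<b (<-trans b≤N (≰⇒> p≰1+N))))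
      , All.zip (All-resp-⊆ us⊆ (Allₚ.applyUpTo⁺₁ id (suc N) s≤s⁻¹) , good))
      where
      open ≤-Reasoning
      rearrange : ∀ a u i → a + u + i ≡ a + i + u
      rearrange = solve-∀
      s≤N+i : s ≤ N + i
      s≤N+i = +-cancelʳ-≤ i s (N + i) (≤-trans s+i≤N₀ (≤-reflexive (trans (sym eq) (sym (+-assoc N i i)))))
      bound : suc s ≤ 2 * r + i + length us
      bound = begin
        suc s                      ≤⟨ s≤s s≤N+i ⟩
        suc N + i                  ≤⟨ +-monoˡ-≤ i (subst (_≤ 2 * r + length us) (length-applyUpTo id (suc N)) len) ⟩
        2 * r + length us + i      ≡⟨ rearrange (2 * r) (length us) i ⟩
        2 * r + i + length us      ∎
    enough i N eq | no p≰1+N | no s+i≰N₀ with s + i ≤? suc N₀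
    -- From `s + maxList K ≤ suc N₀ < s + i` comes `maxList K < i`, and from
    -- `N + (i + i) = N₀ < s + i` comes `i + N < s < p`.
    ... | no s+i≰1+N₀ = inj₁ λ t t≤N →
        Good-above (<-≤-trans max<i (m≤m+n i t)) (≤-<-trans (≤-trans (s≤s (+-monoʳ-≤ i t≤N)) i+N<s) s<p)
      where
      max<i : maxList K < i
      max<i = +-cancelˡ-< s _ _ (≤-<-trans s+max≤ (≰⇒> s+i≰1+N₀))
      i+N<s : i + N < s
      i+N<s = +-cancelʳ-< i _ _ (≤-<-trans (≤-reflexive (trans (lemma i N) eq)) (≰⇒> s+i≰N₀))
        where
        lemma : ∀ i N → i + N + i ≡ N + (i + i)
        lemma = solve-∀
    -- Now `s + i = suc N₀`, so only `maxList K ≤ i` follows and layer `i` may be bad. The other `N`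
    -- layers suffice because `s = suc (i + N)` and `r` is positive.
    ... | yes s+i≤1+N₀ = inj₂
      ( applyUpTo suc N
      , subst (suc s ∸ 2 * r ∸ i ≤_) (sym (length-applyUpTo suc N))
          (subst (_≤ N) (sym (∸-+-assoc (suc s) (2 * r) i)) (m≤n+o⇒m∸n≤o (suc s) (2 * r + i) bound))
      , AllPairsₚ.applyUpTo⁺₁ suc N (λ a<b b<N → p∤difference (s≤s a<b) (<-trans (s≤s b<N) (≰⇒> p≰1+N)))
      , Allₚ.applyUpTo⁺₁ suc N (λ {t} t<N → t<N ,
          Good-above (≤-<-trans max≤i (m<m+n i z<s))
                     (≤-<-trans (≤-trans (s≤s (+-monoʳ-≤ i t<N)) i+N<s) s<p)))
      where
      open ≤-Reasoning
      s+i≡ : s + i ≡ suc N₀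
      s+i≡ = ≤-antisym s+i≤1+N₀ (≰⇒> s+i≰N₀)
      max≤i : maxList K ≤ i
      max≤i = +-cancelˡ-≤ s _ _ (≤-trans s+max≤ (≤-reflexive (sym s+i≡)))
      s≡ : s ≡ suc (i + N)
      s≡ = +-cancelʳ-≡ i s (suc (i + N)) (trans s+i≡ (cong suc (trans (sym eq) (lemma i N))))
        where
        lemma : ∀ i N → N + (i + i) ≡ i + N + i
        lemma = solve-∀
      i+N<s : i + N < s
      i+N<s = ≤-reflexive (sym s≡)
      bound : suc s ≤ 2 * r + i + N
      bound = begin
        suc s              ≡⟨ cong suc s≡ ⟩
        2 * 1 + (i + N)    ≤⟨ +-monoˡ-≤ (i + N) (*-monoʳ-≤ 2 0<r) ⟩
        2 * r + (i + N)    ≡⟨ +-assoc (2 * r) i N ⟨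
        2 * r + i + N      ∎

-- The polynomials attached to the family and their independence.

module Families (p : ℕ) (p-prime : Prime p) where
  open CubeFunctions
  open Modular p p-prime
  open import Data.Bool using (true; false)
  open import Data.Fin using (Fin; splitAt; _↑ˡ_; _↑ʳ_)
  open import Data.Fin.Properties using (splitAt⁻¹-↑ˡ; splitAt⁻¹-↑ʳ)
  open import Data.Fin.Subset using (Subset; ∣_∣; _∩_; ⊤)
  open import Data.Fin.Subset.Properties using (∩-identityˡ; ∩-idem)
  open import Data.Integer using (ℤ; +_; _+_; _-_; _*_)
  open import Data.Integer.Divisibility.Signed using (divides; ∣n⇒∣m*n; ∣m⇒∣m*n; ∣m+n∣m⇒∣n; ∣m+n∣n⇒∣m)
  open import Data.Integer.Properties using (*-identityˡ; pos-*)
  open import Data.Integer.Tactic.RingSolver using (solve-∀)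
  open import Data.List using (List; []; _∷_; length; _++_)
  open import Data.List.Membership.Propositional using (_∈_; _∉_)
  open import Data.List.Properties using (length-++)
  open import Data.List.Relation.Unary.All as All using (All; []; _∷_)
  import Data.List.Relation.Unary.All.Properties as Allₚ
  open import Data.List.Relation.Unary.Any using (here; there)
  open import Data.List.Relation.Unary.Unique.Propositional using (Unique)
  import Data.List.Relation.Unary.Unique.Propositional.Properties as Uniqueₚ
  open import Data.Nat as ℕ using (zero; suc; NonZero)
  open import Data.Nat.DivMod using (_%_; _/_; m≡m%n+[m/n]*n; m%n<n)
  open import Data.Nat.Primality using (prime⇒nonZero)
  import Data.Nat.Properties as ℕₚ
  import Data.Nat.Tactic.RingSolver as ℕ-solver
  open import Data.Product using (_,_; proj₁; proj₂)
  open import Data.Sum using (_⊎_; inj₁; inj₂)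
  open import Data.Vec using (_∷_; head; tail)
  import Data.Vec.Functional as Vector
  open import Data.Vec.Functional.Properties using (lookup-++ˡ; lookup-++ʳ)
  open import Function using (_∘_)
  open import Relation.Binary.Definitions using (tri<; tri≈; tri>)
  open import Relation.Binary.PropositionalEquality
  open import Relation.Nullary using (yes; no; contradiction)

  private instance
    p-nonZero : NonZero p
    p-nonZero = prime⇒nonZero p-prime

  ∏ : List ℕ → ℕ → ℤ
  ∏ []       t = + 1
  ∏ (l ∷ ls) t = (+ t - + l) * ∏ ls t

  -- The offset `a` serves both the dropped coordinate in `f` and the shifted factor of `Q`; the
  -- trailing `F` allows several products to be multiplied in turn.
  Deg-∏ : ∀ {N} ls a (v : Subset N) t {F : Subset N → ℤ} → Deg t F →
          Deg (length ls ℕ.+ t) (λ x → ∏ ls (a ℕ.+ ∣ v ∩ x ∣) * F x)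
  Deg-∏ []       a v t {F} d = Deg-cong t (λ x → sym (*-identityˡ (F x))) d
  Deg-∏ (l ∷ ls) a v t {F} d =
    Deg-cong (suc (length ls ℕ.+ t))
      (λ x → lemma (+ ∣ v ∩ x ∣) (+ l) (+ a) (∏ ls (a ℕ.+ ∣ v ∩ x ∣)) (F x))
      (Deg-affine (length ls ℕ.+ t) v (+ l - + a) (Deg-∏ ls a v t d))
    where
    lemma : ∀ c l a P F → (c - (l - a)) * (P * F) ≡ (a + c - l) * P * F
    lemma = solve-∀

  p∣∏ : ∀ {ls l} t → l ∈ ls → p∣ (+ t - + l) → p∣ ∏ ls t
  p∣∏ {l ∷ ls} t (here refl) h = ∣m⇒∣m*n (∏ ls t) h
  p∣∏ {k ∷ ls} t (there l∈)  h = ∣n⇒∣m*n (+ t - + k) (p∣∏ t l∈ h)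

  p∤∏ : ∀ {ls} t → All (λ l → p∤ (+ t - + l)) ls → p∤ ∏ ls t
  p∤∏ t []       = p∤1
  p∤∏ {l ∷ ls} t (h ∷ hs) = p∤-* (+ t - + l) (∏ ls t) h (p∤∏ t hs)

  p∣-residue : ∀ t → p∣ (+ t - + (t % p))
  p∣-residue t = divides (+ (t / p)) (trans
    (cong (λ z → + z - + (t % p)) (m≡m%n+[m/n]*n t p))
    (trans (lemma (+ (t % p)) (+ (t / p ℕ.* p))) (pos-* (t / p) p)))
    where
    lemma : ∀ a b → a + b - a ≡ b
    lemma = solve-∀

  congruent<p⇒≡ : ∀ {a b} → a ℕ.< p → b ℕ.< p → p∣ (+ a - + b) → a ≡ b
  congruent<p⇒≡ {a} {b} a<p b<p h with ℕₚ.<-cmp a b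
  ... | tri< a<b _ _ = contradiction (≈-sym {+ a} {+ b} h) (p∤difference a<b b<p)

  ... | tri≈ _ a≡b _ = a≡b
  ... | tri> _ _ b<a = contradiction h (p∤difference b<a a<p)

  p∣∏-residue : ∀ ls t → (t % p) ∈ ls → p∣ ∏ ls t
  p∣∏-residue ls t t∈ = p∣∏ t t∈ (p∣-residue t)

  p∤∏-residue : ∀ ls t → All (ℕ._< p) ls → (t % p) ∉ ls → p∤ ∏ ls t
  p∤∏-residue ls t all< t∉ = p∤∏ t (All.tabulate λ {l} l∈ h →
    t∉ (subst (_∈ ls) (sym (congruent<p⇒≡ (m%n<n t p) (All.lookup all< l∈)
      (≈-trans {+ (t % p)} {+ t} {+ l} (≈-sym {+ t} {+ (t % p)} (p∣-residue t)) h))) l∈))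

  Deg-sum : ∀ {N a} t (F : Fin a → Subset N → ℤ) → (∀ i → Deg t (F i)) → Deg t (λ x → sum (λ i → F i x))
  Deg-sum {a = zero}  t F d = Deg-zero t
  Deg-sum {a = suc a} t F d = Deg-+ t (d Fin.zero) (Deg-sum t (F ∘ Fin.suc) (d ∘ Fin.suc))

  module _ {N a b : ℕ} (f : Fin a → Subset N → ℤ) (h : Fin b → Subset N → ℤ) where

    ++-all : ∀ {P : (Subset N → ℤ) → Set} → (∀ i → P (f i)) → (∀ j → P (h j)) → ∀ k → P ((f Vector.++ h) k)
    ++-all Pf Ph k with splitAt a k
    ... | inj₁ i = Pf i
    ... | inj₂ j = Ph j

    -- Evaluation at the points `y j` removes the second family and forces the first coefficients to
    -- vanish mod `p`; what remains is a relation in the second family alone.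
    Independent-++ : (y : Fin a → Subset N) → (∀ i j → p∣ h j (y i)) →
      (∀ (c : Fin a → ℤ) → (∀ j → p∣ sum (λ i → c i * f i (y j))) → ∀ i → p∣ c i) →
      Independent h → Independent (f Vector.++ h)
    Independent-++ y h-vanishes f-indep h-indep c hc k = coefficient (splitAt a k) refl
      where
      cˡ = λ i → c (i ↑ˡ b)
      cʳ = λ j → c (a ↑ʳ j)

      split : ∀ x → p∣ (sum (λ i → cˡ i * f i x) + sum (λ j → cʳ j * h j x))
      split x = subst p∣_ (trans (sum-++ a (λ k → c k * (f Vector.++ h) k x))
        (cong₂ _+_ (sum-cong-≗ (λ i → cong (λ F → cˡ i * F x) (lookup-++ˡ f h i)))
                   (sum-cong-≗ (λ j → cong (λ F → cʳ j * F x) (lookup-++ʳ f h j))))) (hc x)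

      p∣cˡ : ∀ i → p∣ cˡ i
      p∣cˡ = f-indep cˡ λ j → ∣m+n∣n⇒∣m {m = sum (λ i → cˡ i * f i (y j))} (split (y j))
        (p∣-sum (λ i → cʳ i * h i (y j)) (λ i → ∣n⇒∣m*n (cʳ i) (h-vanishes j i)))

      p∣cʳ : ∀ j → p∣ cʳ j
      p∣cʳ = h-indep cʳ λ x → ∣m+n∣m⇒∣n {m = sum (λ i → cˡ i * f i x)} (split x)
        (p∣-sum (λ i → cˡ i * f i x) (λ i → ∣m⇒∣m*n (f i x) (p∣cˡ i)))

      coefficient : ∀ s → splitAt a k ≡ s → p∣ c k
      coefficient (inj₁ i) eq = subst (λ k → p∣ c k) (splitAt⁻¹-↑ˡ eq) (p∣cˡ i)
      coefficient (inj₂ j) eq = subst (λ k → p∣ c k) (splitAt⁻¹-↑ʳ eq) (p∣cʳ j)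

  module _ (L K : List ℕ) (L-unique : Unique L) (K-unique : Unique K)
           (L<p : All (ℕ._< p) L) (K<p : All (ℕ._< p) K) (disjoint : ∀ x → x ∈ L → x ∉ K)
           {N m : ℕ} (A : Fin m → Subset (suc N))
           (sizes : ∀ i → (∣ A i ∣ % p) ∈ K)
           (intersections : ∀ i j → i ≢ j → (∣ A i ∩ A j ∣ % p) ∈ L)
           (0<r : 0 ℕ.< length K) (s+max≤n : length L ℕ.+ maxList K ℕ.≤ suc N) where
    open Layers p p-prime K using (Good; enough)
    open Counting using (unique<⇒length≤)

    s = length L
    r = length K
    e = suc s ℕ.∸ 2 ℕ.* r

    -- `L` and `K` together list distinct numbers below `p`.
    s+r≤p : s ℕ.+ r ℕ.≤ p
    s+r≤p = subst (ℕ._≤ p) (length-++ L) (unique<⇒length≤ (L ++ K)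
      (Uniqueₚ.++⁺ L-unique K-unique (λ { (x∈L , x∈K) → disjoint _ x∈L x∈K })) (Allₚ.++⁺ L<p K<p))

    -- The first coordinate of x is dropped and read as 1.
    f : Fin m → Subset N → ℤ
    f i x = ∏ L (⟦ head (A i) ⟧ ℕ.+ ∣ tail (A i) ∩ x ∣)

    Deg-f : ∀ i → Deg (suc s) (f i)
    Deg-f i = subst (λ t → Deg t (f i)) (ℕₚ.+-comm s 1)
      (Deg-cong (s ℕ.+ 1) (λ x → lemma (f i x)) (Deg-∏ L ⟦ head (A i) ⟧ (tail (A i)) 1 (Deg-const 0 (+ 1))))
      where
      lemma : ∀ a → a * + 1 ≡ a
      lemma = solve-∀

    -- Reading the dropped coordinate of `Y` as 1 is wrong only when `X` contains the first element
    -- and `Y` does not.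
    ∣∩∣-split : ∀ (X Y : Subset (suc N)) → head X ≡ false ⊎ head Y ≡ true →
                ⟦ head X ⟧ ℕ.+ ∣ tail X ∩ tail Y ∣ ≡ ∣ X ∩ Y ∣
    ∣∩∣-split (false ∷ X) (y ∷ Y)    _         = refl
    ∣∩∣-split (true ∷ X)  (true ∷ Y) _         = refl
    ∣∩∣-split (true ∷ X)  (false ∷ Y) (inj₁ ())
    ∣∩∣-split (true ∷ X)  (false ∷ Y) (inj₂ ())

    f-diagonal : ∀ i → p∤ f i (tail (A i))
    f-diagonal i = subst (λ t → p∤ ∏ L t)
      (sym (trans (∣∩∣-split (A i) (A i) (either (head (A i)))) (cong ∣_∣ (∩-idem (A i)))))
      (p∤∏-residue L ∣ A i ∣ L<p (λ ∈L → disjoint _ ∈L (sizes i)))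
      where
      either : ∀ b → b ≡ false ⊎ b ≡ true
      either false = inj₁ refl
      either true  = inj₂ refl

    f-off-diagonal : ∀ i j → i ≢ j → head (A i) ≡ false ⊎ head (A j) ≡ true → p∣ f i (tail (A j))
    f-off-diagonal i j i≢j c = subst (λ t → p∣ ∏ L t) (sym (∣∩∣-split (A i) (A j) c))
      (p∣∏-residue L ∣ A i ∩ A j ∣ (intersections i j i≢j))

    -- The matrix f i (tail (A j)) is block triangular: columns with head true come first.
    f-independent : ∀ (c : Fin m → ℤ) → (∀ j → p∣ sum (λ i → c i * f i (tail (A j)))) → ∀ i → p∣ c i
    f-independent c h j = by-head (head (A j)) refl
      where
      isolate : ∀ j → (∀ i → i ≢ j → p∣ c i * f i (tail (A j))) → p∣ c j
      isolate j others = p∣-cancelˡ (f j (tail (A j))) (c j) (f-diagonal j)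
        (subst p∣_ (lemma (c j) (f j (tail (A j))))
          (p∣-sum-remainder (λ i → c i * f i (tail (A j))) j others (h j)))
        where
        lemma : ∀ a b → a * b ≡ b * a
        lemma = solve-∀

      with-first : ∀ j → head (A j) ≡ true → p∣ c j
      with-first j eq = isolate j λ i i≢j → ∣n⇒∣m*n (c i) (f-off-diagonal i j i≢j (inj₂ eq))

      by-head : ∀ b → head (A j) ≡ b → p∣ c j
      by-head true  eq = with-first j eq
      by-head false eq = isolate j other
        where
        other : ∀ i → i ≢ j → p∣ c i * f i (tail (A j))
        other i i≢j with head (A i) in hi
        -- The uncontrolled entries of the matrix sit here, where `c i` is already known to vanish
        -- mod `p`.
        ... | true  = ∣m⇒∣m*n (∏ L (1 ℕ.+ ∣ tail (A i) ∩ tail (A j) ∣)) (with-first i hi)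
        ... | false = ∣n⇒∣m*n (c i) (subst (λ b → p∣ ∏ L (⟦ b ⟧ ℕ.+ ∣ tail (A i) ∩ tail (A j) ∣)) hi
                        (f-off-diagonal i j i≢j (inj₁ hi)))

    Q : ℕ → ℤ
    Q t = ∏ K t * ∏ K (suc t)

    h : Fin (dim N e) → Subset N → ℤ
    h j x = Q ∣ x ∣ * basis e x j

    Deg-h : ∀ j → Deg (suc s) (h j)
    Deg-h j with 2 ℕ.* r ℕ.≤? suc s
    ... | yes 2r≤1+s = subst (λ t → Deg t (h j)) total
            (Deg-cong (r ℕ.+ (r ℕ.+ e)) unfold (Deg-∏ K 0 ⊤ (r ℕ.+ e) (Deg-∏ K 1 ⊤ e (Deg-basis e j))))
      where
      total : r ℕ.+ (r ℕ.+ e) ≡ suc s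
      total = trans (lemma r e) (ℕₚ.m+[n∸m]≡n 2r≤1+s)
        where
        lemma : ∀ r e → r ℕ.+ (r ℕ.+ e) ≡ 2 ℕ.* r ℕ.+ e
        lemma = ℕ-solver.solve-∀
      unfold : ∀ x → ∏ K ∣ ⊤ ∩ x ∣ * (∏ K (suc ∣ ⊤ ∩ x ∣) * basis e x j) ≡ h j x
      unfold x rewrite ∩-identityˡ x = lemma (∏ K ∣ x ∣) (∏ K (suc ∣ x ∣)) (basis e x j)
        where
        lemma : ∀ a b c → a * (b * c) ≡ a * b * c
        lemma = solve-∀
    -- Here `e` is 0, so there is no index `j`.
    ... | no 2r≰1+s with subst (λ t → Fin (dim N t)) (ℕₚ.m≤n⇒m∸n≡0 (ℕₚ.<⇒≤ (ℕₚ.≰⇒> 2r≰1+s))) j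
    ...   | ()

    -- Dropping a coordinate lowers the size by 0 or 1; the two factors of `Q` handle these cases.
    h-vanishes : ∀ i j → p∣ h j (tail (A i))
    h-vanishes i j = ∣m⇒∣m*n (basis e (tail (A i)) j) (go (A i) (sizes i))
      where
      go : ∀ (X : Subset (suc N)) → (∣ X ∣ % p) ∈ K → p∣ Q ∣ tail X ∣
      go (false ∷ X) ∈K = ∣m⇒∣m*n (∏ K (suc ∣ X ∣)) (p∣∏-residue K ∣ X ∣ ∈K)
      go (true ∷ X)  ∈K = ∣n⇒∣m*n (∏ K ∣ X ∣) (p∣∏-residue K (suc ∣ X ∣) ∈K)

    Good⇒p∤Q : ∀ t → Good t → p∤ Q t
    Good⇒p∤Q t good = p∤-* (∏ K t) (∏ K (suc t)) (p∤∏ t (All.map proj₁ good)) (p∤∏ (suc t) (All.map proj₂ good))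

    -- A combination of the `h j` is `Q ∣ x ∣ * g x`. On good layers `Q` is prime to `p`, so `g`
    -- vanishes there, then everywhere by `vanishes`, and its monomial coefficients are 0 mod `p`.
    h-independent : Independent h
    h-independent c hc = basis-independent e c
      (vanishes Good N e e≤p (enough s N s+r≤p 0<r s+max≤n) N 0 (ℕₚ.+-identityʳ N) g
        (Deg-sum e (λ j x → c j * basis e x j) (λ j → Deg-scale e (c j) (Deg-basis e j)))
        (λ x good → p∣-cancelˡ (Q ∣ x ∣) (g x) (Good⇒p∤Q ∣ x ∣ good) (subst p∣_ (factor x) (hc x))))
      where
      g : Subset N → ℤ
      g x = sum (λ j → c j * basis e x j)

      factor : ∀ x → sum (λ j → c j * h j x) ≡ Q ∣ x ∣ * g x
      factor x = trans (sum-cong-≗ (λ j → lemma (c j) (Q ∣ x ∣) (basis e x j)))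
        (sym (*-distribˡ-sum (Q ∣ x ∣) (λ j → c j * basis e x j)))
        where
        lemma : ∀ a b c → a * (b * c) ≡ b * (a * c)
        lemma = solve-∀

      e≤p : e ℕ.≤ p
      e≤p = ℕₚ.≤-trans (ℕₚ.m∸n≤m (suc s) (2 ℕ.* r))
        (ℕₚ.≤-trans (ℕₚ.≤-reflexive (ℕₚ.+-comm 1 s)) (ℕₚ.≤-trans (ℕₚ.+-monoʳ-≤ s 0<r) s+r≤p))

    m+dim≤dim : m ℕ.+ dim N e ℕ.≤ dim N (suc s)
    m+dim≤dim = independent⇒≤dim (suc s) (f Vector.++ h)
      (++-all f h {Deg (suc s)} Deg-f Deg-h)
      (Independent-++ f h (tail ∘ A) h-vanishes f-independent h-independent)

-- From the dimension inequality to the binomial bound.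

open import Data.Nat using (NonZero; _+_; _*_; _∸_; _≤_; _<_; _%_)
open import Data.Fin using (Fin)
open import Data.Fin.Subset using (Subset; ∣_∣; _∩_)
open import Data.List using (length)
open import Data.List.Membership.Propositional using (_∈_; _∉_)
open import Data.List.Relation.Unary.All using (All)
open import Data.List.Relation.Unary.Unique.Propositional using (Unique)
open import Function.Definitions using (Injective)
open import Relation.Binary.PropositionalEquality using (_≡_; _≢_)
open import Data.Fin using (zero; suc)
open import Data.List using ([]; _∷_)
open import Data.Nat using (zero; suc; z≤n; s≤s)
open import Data.Nat.Properties using (≤-refl; ≤-reflexive; ≤-trans; +-cancelʳ-≤; m≤n⇒m∸n≡0; *-monoʳ-≤; m+n≡0⇒m≡0; n≤0⇒n≡0; +-identityʳ)
open import Data.Vec using ([])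
open import Relation.Binary.PropositionalEquality using (refl; sym; trans; cong; subst)
open CubeFunctions using (dim)
open Counting using (binomSum-dim)

length-positive : ∀ {x} {xs : List ℕ} → x ∈ xs → 0 < length xs
length-positive {xs = _ ∷ _} _ = s≤s z≤n

subsingleton-family : ∀ {m} (A : Fin m → Subset 0) → Injective _≡_ _≡_ A → m ≤ 1
subsingleton-family {zero}        A inj = z≤n
subsingleton-family {suc zero}    A inj = ≤-refl
subsingleton-family {suc (suc m)} A inj with inj {zero} {suc zero} (all-equal (A zero) (A (suc zero)))
  where
  all-equal : ∀ (X Y : Subset 0) → X ≡ Y
  all-equal [] [] = refl
... | ()

theorem1p14 : (p : ℕ) → Prime p → .{{_ : NonZero p}} → (L K : List ℕ) →
    Unique L → Unique K → All (λ l → l < p) L → All (λ k → k < p) K →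
    (∀ x → x ∈ L → x ∉ K) →
    (n m : ℕ) → (A : Fin m → Subset n) → Injective _≡_ _≡_ A →
    (∀ i → (∣ A i ∣ % p) ∈ K) →
    (∀ i j → i ≢ j → (∣ A i ∩ A j ∣ % p) ∈ L) →
    length L + maxList K ≤ n →
    m ≤ binomSum (n ∸ 1) (length L) (2 * length K)
-- The empty family is separate: the other clauses use a member to see that `K` is nonempty.
theorem1p14 p p-prime L K uL uK L<p K<p disjoint n zero A inj sizes inters s+max≤n = z≤n
-- There is no element to drop; `length L` is 0 and the sum reduces to `0 C 0`, which is 1.
theorem1p14 p p-prime L K uL uK L<p K<p disjoint zero m@(suc _) A inj sizes inters s+max≤n =
  ≤-trans (subsingleton-family A inj) (≤-reflexive (sym sum≡1))
  where
  s≡0 : length L ≡ 0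
  s≡0 = m+n≡0⇒m≡0 (length L) (n≤0⇒n≡0 s+max≤n)
  1≤2r : 1 ≤ 2 * length K
  1≤2r = ≤-trans (s≤s z≤n) (*-monoʳ-≤ 2 (length-positive (sizes zero)))
  sum≡1 : binomSum 0 (length L) (2 * length K) ≡ 1
  sum≡1 = subst (λ s → binomSum 0 s (2 * length K) ≡ 1) (sym s≡0)
    (trans (sym (+-identityʳ _))
      (trans (cong (λ t → binomSum 0 0 (2 * length K) + dim 0 t) (sym (m≤n⇒m∸n≡0 1≤2r)))
             (binomSum-dim 0 0 (2 * length K))))
theorem1p14 p p-prime L K uL uK L<p K<p disjoint (suc N) m@(suc _) A inj sizes inters s+max≤n =
  -- After adding the dimension for degree at most `s - 2r` to both sides, the right side telescopes
  -- to the full dimension.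
  +-cancelʳ-≤ (dim N (suc (length L) ∸ 2 * length K)) m _
    (≤-trans (Families.m+dim≤dim p p-prime L K uL uK L<p K<p disjoint A sizes inters
               (length-positive (sizes zero)) s+max≤n)
             (≤-reflexive (sym (binomSum-dim N (length L) (2 * length K)))))
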